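{- Let $L>4$ and let $S\subseteq\mathbb{S}_L$ be a dense subset. Then any g.e.c. graph $G$ on vertex set $S$ defines, in the language of graphs and with parameters from $S$, the ternary relations $\{C_{z,t,k}: z,t,k\in\mathbb{Z}\}$ on $S$ and the partial functions $f_z: a\mapsto a+z$ on $S$ (defined at those $a\in S$ with $a+z\in S$), for all $z\in\mathbb{Z}$.
   Context: For real $L\ge2$, the circle of length $L$ is the quotient group $\mathbb{S}_L=(\mathbb{R}/L\mathbb{Z},+_L)$; for $x\in\mathbb{R}$ write $[x]=x+L\mathbb{Z}$, and for $a\in \mathbb{S}_L$, $z\in\mathbb{Z}$ write $a+z$ for $a+_L[z]$. It carries the metric $d_L(a,b)=\min\{|x-y|,L-|x-y|\}$, where $x,y\in[0,L)$ are the unique elements with $[x]=a,[y]=b$. The circular order $C(a,b,c)$ on $\mathbb{S}_L$ holds iff $x<y<z$ or $y<z<x$ or $z<x<y$, where $x,y,z\in[0,L)$ are such that $[x]=a,[y]=b,[z]=c$. For $z,t,k\in\mathbb{Z}$ and $a,b,c\in S$, $C_{z,t,k}(a,b,c)$ holds iff $C(a+z,b+t,c+k)$. Let $(X,d)$ be a separable metric space without isolated points and $S\subseteq X$ dense. A (simple, undirected) graph $G$ with vertex set $S$ is geometrically existentially closed (g.e.c.) if (i) any two adjacent $u,v\in S$ satisfy $d(u,v)<1$; and (ii) for any vertex $s\in S$, any disjoint finite sets $A,B\subseteq S$ contained in the open unit ball $B_1(s)$, and any $\epsilon>0$, there is a vertex $v\in S\setminus(A\cup B)$ with $d(s,v)<\epsilon$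 such that $v$ is adjacent to every vertex in $A$ and to no vertex in $B$. -}

module Defs where

open import Algebra.Bundles using (CommutativeRing; AbelianGroup)
open import Axiom.ExcludedMiddle using (ExcludedMiddle)
open import Data.Empty using (⊥)
open import Data.Fin.Base using (Fin)
open import Data.Integer.Base as ℤ using (ℤ; -[1+_]; _⊖_)
import Data.Integer.Properties as ℤₚ
open import Data.List.Base using (List)
open import Data.List.Relation.Unary.All using (All)
import Data.List.Membership.Setoid as Membership
import Data.List.Relation.Binary.Disjoint.Setoid as DisjointLists
open import Data.Nat.Base as ℕ using (ℕ; zero; suc)
import Data.Nat.Properties as ℕₚ
open import Data.Product.Base using (Σ; ∃; ∃-syntax; _×_; _,_; proj₁; proj₂)
open import Data.Sum.Base using (_⊎_; inj₁; inj₂)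
open import Data.Vec.Base using (Vec; []; _∷_; lookup; _++_)
open import Function.Bundles using (_⇔_)
open import Level using (0ℓ)
open import Relation.Binary.Bundles using (Setoid; StrictTotalOrder; DecTotalOrder; TotalOrder)
open import Relation.Binary.Core using (Rel)
open import Relation.Binary.Definitions
  using (Irreflexive; Symmetric; _Respects₂_; tri<; tri≈; tri>)
open import Relation.Binary.PropositionalEquality.Core as ≡ using (_≡_)
open import Relation.Binary.Structures using (IsStrictTotalOrder)
import Relation.Binary.Construct.On as On
import Relation.Binary.Properties.StrictTotalOrder as StrictTotalOrderProperties
import Relation.Binary.Reasoning.Setoid as SetoidReasoning
import Algebra.Construct.NaturalChoice.Max as Maximum
import Algebra.Construct.NaturalChoice.Min as Minimum
import Algebra.Definitions.RawMonoid as NatMultiples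
import Algebra.Properties.AbelianGroup as AbelianGroupProperties
import Algebra.Properties.CommutativeSemigroup as CommutativeSemigroupProperties
import Algebra.Properties.Monoid.Mult as MultProperties
open import Relation.Nullary using (¬_; yes; no; contradiction)
open import Relation.Unary using (Pred; Satisfiable)

-- The axioms of the real line, which determine it up to isomorphism.  The
-- library has no type of reals, so ℝ is an arbitrary model of these axioms.

record CompleteOrderedField : Set₁ where
  infix 4 _<_

  field
    commutativeRing : CommutativeRing 0ℓ 0ℓ

  open CommutativeRing commutativeRing public

  field
    inverse            : ∀ {x} → ¬ (x ≈ 0#) → ∃[ y ] x * y ≈ 1#
    _<_                : Rel Carrier 0ℓ
    isStrictTotalOrder : IsStrictTotalOrder _≈_ _<_
    0<1                : 0# < 1#
    +-monoˡ-<          : ∀ {x y} z → x < y → x + z < y + z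
    *-pos              : ∀ {x y} → 0# < x → 0# < y → 0# < x * y

  strictTotalOrder : StrictTotalOrder 0ℓ 0ℓ 0ℓ
  strictTotalOrder = record { isStrictTotalOrder = isStrictTotalOrder }

  decTotalOrder : DecTotalOrder 0ℓ 0ℓ 0ℓ
  decTotalOrder = StrictTotalOrderProperties.decTotalOrder strictTotalOrder

  totalOrder : TotalOrder 0ℓ 0ℓ 0ℓ
  totalOrder = DecTotalOrder.totalOrder decTotalOrder

  open TotalOrder totalOrder public using (_≤_)

  UpperBound : Pred Carrier 0ℓ → Pred Carrier 0ℓ
  UpperBound P b = ∀ {x} → P x → x ≤ b

  field
    supremum : (P : Pred Carrier 0ℓ) → Satisfiable P → Satisfiable (UpperBound P) →
               ∃[ s ] UpperBound P s × (∀ {b} → UpperBound P b → s ≤ b)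

  open Minimum totalOrder public using (_⊓_)
  open Maximum totalOrder public using (_⊔_)

  ∣_∣ : Carrier → Carrier
  ∣ x ∣ = x ⊔ (- x)

  open NatMultiples +-rawMonoid public using () renaming (_×_ to _·ℕ_)

  infixr 8 _·_

  _·_ : ℤ → Carrier → Carrier
  (ℤ.+ n)  · x = n ·ℕ x
  -[1+ n ] · x = - (suc n ·ℕ x)

  fromℤ : ℤ → Carrier
  fromℤ z = z · 1#

module RealLemmas (ℝ : CompleteOrderedField) where
  open CompleteOrderedField ℝ
  open AbelianGroupProperties +-abelianGroup
    using (⁻¹-∙-comm; ⁻¹-involutive; ε⁻¹≈ε)
  open CommutativeSemigroupProperties
    (AbelianGroup.commutativeSemigroup +-abelianGroup) using (interchange)
  open MultProperties +-monoid using (×-homo-+)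
  open SetoidReasoning setoid
  private
    module < = IsStrictTotalOrder isStrictTotalOrder
    module ≤ = TotalOrder totalOrder

  <-≤-trans : ∀ {x y z} → x < y → y ≤ z → x < z
  <-≤-trans x<y (inj₁ y<z) = <.trans x<y y<z
  <-≤-trans x<y (inj₂ y≈z) = <.<-respʳ-≈ y≈z x<y

  ≤-<-trans : ∀ {x y z} → x ≤ y → y < z → x < z
  ≤-<-trans (inj₁ x<y) y<z = <.trans x<y y<z
  ≤-<-trans (inj₂ x≈y) y<z = <.<-respˡ-≈ (sym x≈y) y<z

  +-monoˡ-≤ : ∀ {x y} z → x ≤ y → x + z ≤ y + z
  +-monoˡ-≤ z (inj₁ x<y) = inj₁ (+-monoˡ-< z x<y)
  +-monoˡ-≤ z (inj₂ x≈y) = inj₂ (+-congʳ x≈y)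

  ≮⇒≥ : ∀ {x y} → ¬ (x < y) → y ≤ x
  ≮⇒≥ {x} {y} x≮y with <.compare x y
  ... | tri< x<y _ _ = contradiction x<y x≮y
  ... | tri≈ _ x≈y _ = inj₂ (sym x≈y)
  ... | tri> _ _ y<x = inj₁ y<x

  x+y-y≈x : ∀ x y → (x + y) - y ≈ x
  x+y-y≈x x y = begin
    (x + y) - y   ≈⟨ +-assoc x y (- y) ⟩
    x + (y - y)   ≈⟨ +-congˡ (-‿inverseʳ y) ⟩
    x + 0#        ≈⟨ +-identityʳ x ⟩
    x             ∎

  x-y+y≈x : ∀ x y → (x - y) + y ≈ x
  x-y+y≈x x y = begin
    (x - y) + y     ≈⟨ +-assoc x (- y) y ⟩
    x + (- y + y)   ≈⟨ +-congˡ (-‿inverseˡ y) ⟩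
    x + 0#          ≈⟨ +-identityʳ x ⟩
    x               ∎

  ⊖-homo : ∀ m n x → (m ⊖ n) · x ≈ (m ·ℕ x) - (n ·ℕ x)
  ⊖-homo m zero x = begin
    m ·ℕ x          ≈⟨ +-identityʳ _ ⟨
    m ·ℕ x + 0#     ≈⟨ +-congˡ ε⁻¹≈ε ⟨
    m ·ℕ x - 0#     ∎
  ⊖-homo zero (suc n) x = sym (+-identityˡ _)
  ⊖-homo (suc m) (suc n) x = begin
    (suc m ⊖ suc n) · x                ≡⟨ ≡.cong (_· x) (ℤₚ.[1+m]⊖[1+n]≡m⊖n m n) ⟩
    (m ⊖ n) · x                        ≈⟨ ⊖-homo m n x ⟩
    (m ·ℕ x) - (n ·ℕ x)                ≈⟨ +-identityˡ _ ⟨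
    0# + ((m ·ℕ x) - (n ·ℕ x))         ≈⟨ +-congʳ (-‿inverseʳ x) ⟨
    (x - x) + ((m ·ℕ x) - (n ·ℕ x))    ≈⟨ interchange x (- x) (m ·ℕ x) _ ⟩
    (x + m ·ℕ x) + (- x - (n ·ℕ x))    ≈⟨ +-congˡ (⁻¹-∙-comm x (n ·ℕ x)) ⟩
    (x + m ·ℕ x) - (x + n ·ℕ x)        ∎

  ·-homo-+ : ∀ i j x → (i ℤ.+ j) · x ≈ i · x + j · x
  ·-homo-+ (ℤ.+ m) (ℤ.+ n) x = ×-homo-+ x m n
  ·-homo-+ (ℤ.+ m) -[1+ n ] x = ⊖-homo m (suc n) x
  ·-homo-+ -[1+ m ] (ℤ.+ n) x = trans (⊖-homo n (suc m) x) (+-comm _ _)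
  ·-homo-+ -[1+ m ] -[1+ n ] x = begin
    - (suc (suc (m ℕ.+ n)) ·ℕ x)          ≡⟨ ≡.cong (λ k → - (suc k ·ℕ x)) (ℕₚ.+-suc m n) ⟨
    - ((suc m ℕ.+ suc n) ·ℕ x)            ≈⟨ -‿cong (×-homo-+ x (suc m) (suc n)) ⟩
    - ((suc m ·ℕ x) + (suc n ·ℕ x))       ≈⟨ ⁻¹-∙-comm (suc m ·ℕ x) (suc n ·ℕ x) ⟨
    - (suc m ·ℕ x) - (suc n ·ℕ x)         ∎

  ·-homo-neg : ∀ i x → (ℤ.- i) · x ≈ - (i · x)
  ·-homo-neg (ℤ.+ zero) x = sym ε⁻¹≈ε
  ·-homo-neg (ℤ.+ suc n) x = refl
  ·-homo-neg -[1+ n ] x = sym (⁻¹-involutive _)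

  x<x+1 : ∀ x → x < 1# + x
  x<x+1 x = <.<-respˡ-≈ (+-identityˡ x) (+-monoˡ-< x 0<1)

  4<x⇒2≤x : ∀ {x} → fromℤ (ℤ.+ 4) < x → fromℤ (ℤ.+ 2) ≤ x
  4<x⇒2≤x 4<x = inj₁ (<.trans (<.trans (x<x+1 _) (x<x+1 _)) 4<x)

  2≤x⇒0<x : ∀ {x} → fromℤ (ℤ.+ 2) ≤ x → 0# < x
  2≤x⇒0<x 2≤x = <-≤-trans (<.trans (x<x+1 0#) (x<x+1 _)) 2≤x

  module _ (em : ExcludedMiddle 0ℓ) {L : Carrier} (0<L : 0# < L) where

    archimedean : ∀ x → ∃[ n ] x < n ·ℕ L
    archimedean x with em {∃[ n ] x < n ·ℕ L}
    ... | yes p = p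
    ... | no ¬p = contradiction s<s (<.irrefl refl)
      where
      Multiple : Pred Carrier 0ℓ
      Multiple y = ∃[ n ] y ≡ n ·ℕ L

      sup : ∃[ s ] UpperBound Multiple s × (∀ {b} → UpperBound Multiple b → s ≤ b)
      sup = supremum Multiple (0# , 0 , ≡.refl)
              (x , λ { (n , ≡.refl) → ≮⇒≥ λ x<nL → ¬p (n , x<nL) })

      s : Carrier
      s = proj₁ sup

      s≤s-L : s ≤ s - L
      s≤s-L = proj₂ (proj₂ sup) λ { (n , ≡.refl) →
        ≤.trans
          (inj₂ (sym (trans (+-congʳ (+-comm L (n ·ℕ L))) (x+y-y≈x (n ·ℕ L) L))))
          (+-monoˡ-≤ (- L) (proj₁ (proj₂ sup) (suc n , ≡.refl))) }

      s+L≤s : s + L ≤ s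
      s+L≤s = ≤.trans (+-monoˡ-≤ L s≤s-L) (inj₂ (x-y+y≈x s L))

      s<s+L : s < s + L
      s<s+L = <.<-respʳ-≈ (+-comm L s) (<.<-respˡ-≈ (+-identityˡ s) (+-monoˡ-< s 0<L))

      s<s : s < s
      s<s = <-≤-trans s<s+L s+L≤s

    nonNegResidue : ∀ n x → 0# ≤ x → x < n ·ℕ L →
                    ∃[ r ] (0# ≤ r × r < L) × ∃[ m ] r + m ·ℕ L ≈ x
    nonNegResidue zero x 0≤x x<0 = contradiction (≤-<-trans 0≤x x<0) (<.irrefl refl)
    nonNegResidue (suc n) x 0≤x x<L+nL with x <.<? L
    ... | yes x<L = x , (0≤x , x<L) , 0 , +-identityʳ x
    ... | no x≮L = let r , r∈ , m , eq = nonNegResidue n (x - L) 0≤x-L x-L<nL in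
        r , r∈ , suc m , (begin
          r + (L + m ·ℕ L)   ≈⟨ +-congˡ (+-comm L _) ⟩
          r + (m ·ℕ L + L)   ≈⟨ +-assoc r _ L ⟨
          (r + m ·ℕ L) + L   ≈⟨ +-congʳ eq ⟩
          (x - L) + L        ≈⟨ x-y+y≈x x L ⟩
          x                  ∎)
      where
      0≤x-L : 0# ≤ x - L
      0≤x-L = ≤.trans (inj₂ (sym (-‿inverseʳ L))) (+-monoˡ-≤ (- L) (≮⇒≥ x≮L))

      x-L<nL : x - L < n ·ℕ L
      x-L<nL = <.<-respʳ-≈ (trans (+-congʳ (+-comm L _)) (x+y-y≈x _ L))
                 (+-monoˡ-< (- L) x<L+nL)

    residue : ∀ x → ∃[ r ] (0# ≤ r × r < L) × ∃[ k ] x ≈ r + k · L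
    residue x =
      let N , -x<NL = archimedean (- x)
          0<x+NL    = <.<-respʳ-≈ (+-comm _ x)
                        (<.<-respˡ-≈ (-‿inverseˡ x) (+-monoˡ-< x -x<NL))
          M , x+NL<ML = archimedean (x + N ·ℕ L)
          r , r∈ , m , eq = nonNegResidue M (x + N ·ℕ L) (inj₁ 0<x+NL) x+NL<ML
      in r , r∈ , m ⊖ N , (begin
           x                              ≈⟨ x+y-y≈x x _ ⟨
           (x + N ·ℕ L) - (N ·ℕ L)        ≈⟨ +-congʳ eq ⟨
           (r + m ·ℕ L) - (N ·ℕ L)        ≈⟨ +-assoc r _ _ ⟩
           r + ((m ·ℕ L) - (N ·ℕ L))      ≈⟨ +-congˡ (⊖-homo m N L) ⟨
           r + (m ⊖ N) · L                ∎)

record SimpleGraph (V : Setoid 0ℓ 0ℓ) : Set₁ where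
  open Setoid V using (_≈_) renaming (Carrier to Vertex)
  infix 4 _—_
  field
    _—_    : Rel Vertex 0ℓ
    resp   : _—_ Respects₂ _≈_
    sym    : Symmetric _—_
    irrefl : Irreflexive _≈_ _—_

-- First-order formulas with equality in the language of graphs (∼ is adjacency),
-- with free variables among x₀ … xₙ₋₁; a quantifier binds x₀ of its body.

infix  9 _≐_ _∼_
infix  8 neg_
infixr 7 _∧_
infixr 6 _∨_
infixr 5 _⇒_

data Formula : ℕ → Set where
  _≐_ _∼_     : ∀ {n} → Fin n → Fin n → Formula n
  ff          : ∀ {n} → Formula n
  neg_        : ∀ {n} → Formula n → Formula n
  _∧_ _∨_ _⇒_ : ∀ {n} → Formula n → Formula n → Formula n
  all ex      : ∀ {n} → Formula (suc n) → Formula n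

module Definability {V : Setoid 0ℓ 0ℓ} (G : SimpleGraph V) where
  open Setoid V using (_≈_) renaming (Carrier to Vertex)
  open SimpleGraph G

  infix 4 _⊨_

  _⊨_ : ∀ {n} → Vec Vertex n → Formula n → Set
  ρ ⊨ i ≐ j = lookup ρ i ≈ lookup ρ j
  ρ ⊨ i ∼ j = lookup ρ i — lookup ρ j
  ρ ⊨ ff    = ⊥
  ρ ⊨ neg φ = ¬ (ρ ⊨ φ)
  ρ ⊨ φ ∧ ψ = ρ ⊨ φ × ρ ⊨ ψ
  ρ ⊨ φ ∨ ψ = ρ ⊨ φ ⊎ ρ ⊨ ψ
  ρ ⊨ φ ⇒ ψ = ρ ⊨ φ → ρ ⊨ ψ
  ρ ⊨ all φ = ∀ v → v ∷ ρ ⊨ φ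
  ρ ⊨ ex φ  = ∃[ v ] v ∷ ρ ⊨ φ

  -- The entries of ps are the parameters.
  Definable : ∀ {n} → Pred (Vec Vertex n) 0ℓ → Set
  Definable {n} R = ∃[ m ] Σ (Formula (n ℕ.+ m)) λ φ → Σ (Vec Vertex m) λ ps →
    ∀ (vs : Vec Vertex n) → (vs ++ ps ⊨ φ) ⇔ R vs

  -- A partial function with domain D is definable if its graph is.
  Graph : (D : Pred Vertex 0ℓ) → ((v : Vertex) → D v → Vertex) → Pred (Vec Vertex 2) 0ℓ
  Graph D f (v ∷ w ∷ []) = Σ (D v) λ v∈D → f v v∈D ≈ w

  DefinablePartialFunction : (D : Pred Vertex 0ℓ) → ((v : Vertex) → D v → Vertex) → Set
  DefinablePartialFunction D f = Definable (Graph D f)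

module Distance (ℝ : CompleteOrderedField) (X : Setoid 0ℓ 0ℓ)
  (d : Setoid.Carrier X → Setoid.Carrier X → CompleteOrderedField.Carrier ℝ) where

  open CompleteOrderedField ℝ using (_<_; 0#; 1#)
  open Setoid X using () renaming (Carrier to Point)

  Dense : Pred Point 0ℓ → Set
  Dense S = ∀ x {ε} → 0# < ε → ∃[ s ] S s × d x s < ε

  Subspace : Pred Point 0ℓ → Setoid 0ℓ 0ℓ
  Subspace S = On.setoid {B = ∃ S} X proj₁

  -- Finite vertex sets are represented by lists, up to the equality of X.
  record GeometricallyExistentiallyClosed (S : Pred Point 0ℓ)
                                          (G : SimpleGraph (Subspace S)) : Set where
    open SimpleGraph G using (_—_)
    open Membership (Subspace S) using (_∉_)
    open DisjointLists (Subspace S) using (Disjoint)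

    field
      adjacent⇒d<1 : ∀ {u v} → u — v → d (proj₁ u) (proj₁ v) < 1#
      extension    : ∀ (s : ∃ S) (A B : List (∃ S)) → Disjoint A B →
                     All (λ a → d (proj₁ s) (proj₁ a) < 1#) A →
                     All (λ b → d (proj₁ s) (proj₁ b) < 1#) B →
                     ∀ {ε} → 0# < ε →
                     ∃[ v ] v ∉ A × v ∉ B × d (proj₁ s) (proj₁ v) < ε ×
                            All (v —_) A × All (λ b → ¬ (v — b)) B

-- The setting is classical: excluded middle is needed already to choose the
-- representative in [0,L) of a class modulo Lℤ.

module Circle (em : ExcludedMiddle 0ℓ) (ℝ : CompleteOrderedField)
              (L : CompleteOrderedField.Carrier ℝ)
              (2≤L : CompleteOrderedField._≤_ ℝ
                       (CompleteOrderedField.fromℤ ℝ (ℤ.+ 2)) L) where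

  open CompleteOrderedField ℝ
  open RealLemmas ℝ
  open SetoidReasoning setoid

  -- Quotient types are not available, so ℝ/Lℤ is the type of reals with
  -- congruence modulo Lℤ as its equality.  A subset of the circle is then a
  -- predicate that respects _≋_.

  infix 4 _≋_

  _≋_ : Rel Carrier 0ℓ
  x ≋ y = ∃[ k ] x ≈ y + k · L

  𝕊 : Setoid 0ℓ 0ℓ
  𝕊 = record
    { Carrier = Carrier
    ; _≈_ = _≋_
    ; isEquivalence = record
      { refl  = ℤ.+ 0 , sym (+-identityʳ _)
      ; sym   = λ { {x} {y} (k , x≈y+kL) → ℤ.- k , (begin
          y                          ≈⟨ x+y-y≈x y (k · L) ⟨
          (y + k · L) - (k · L)      ≈⟨ +-cong x≈y+kL (·-homo-neg k L) ⟨
          x + (ℤ.- k) · L            ∎) }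
      ; trans = λ { {x} {y} {z} (k , x≈y+kL) (l , y≈z+lL) → l ℤ.+ k , (begin
          x                          ≈⟨ x≈y+kL ⟩
          y + k · L                  ≈⟨ +-congʳ y≈z+lL ⟩
          (z + l · L) + k · L        ≈⟨ +-assoc z _ _ ⟩
          z + (l · L + k · L)        ≈⟨ +-congˡ (·-homo-+ l k L) ⟨
          z + (l ℤ.+ k) · L          ∎) }
      }
    }

  infixl 6 _⊕_

  _⊕_ : Carrier → ℤ → Carrier
  a ⊕ z = a + fromℤ z

  rep : Carrier → Carrier
  rep a = proj₁ (residue em (2≤x⇒0<x 2≤L) a)

  rep-bounds : ∀ a → 0# ≤ rep a × rep a < L
  rep-bounds a = proj₁ (proj₂ (residue em (2≤x⇒0<x 2≤L) a))

  rep-≋ : ∀ a → a ≋ rep a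
  rep-≋ a = proj₂ (proj₂ (residue em (2≤x⇒0<x 2≤L) a))

  d : Carrier → Carrier → Carrier
  d a b = ∣ rep a - rep b ∣ ⊓ (L - ∣ rep a - rep b ∣)

  C : Carrier → Carrier → Carrier → Set
  C a b c = (x < y × y < z) ⊎ (y < z × z < x) ⊎ (z < x × x < y)
    where
    x = rep a
    y = rep b
    z = rep c

  open Distance ℝ 𝕊 d public

  module _ (S : Pred Carrier 0ℓ) where

    C[_,_,_] : ℤ → ℤ → ℤ → Pred (Vec (∃ S) 3) 0ℓ
    C[ z , t , k ] ((a , _) ∷ (b , _) ∷ (c , _) ∷ []) = C (a ⊕ z) (b ⊕ t) (c ⊕ k)

    dom-f : ℤ → Pred (∃ S) 0ℓ
    dom-f z (a , _) = S (a ⊕ z)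

    f : (z : ℤ) (v : ∃ S) → dom-f z v → ∃ S
    f z (a , _) a+z∈S = a ⊕ z , a+z∈S

{-# OPTIONS --safe #-}

-- A point of S has a neighbour in common with another one iff their distance is less than 2.
-- The neighbours of v are dense in the open unit ball around v, so they all lie at distance
-- less than 2 from u iff d(u, v) ≤ 1: the room for a violation beyond is L − 4 > 0.
-- Hence d ≤ 1 is definable, and so is the relation "a and b lie on the same side of o, at
-- distance at most 1 from it": two such points are both near a point not near o.  These
-- comparisons carry the orientation of a pair of parameters p, q around the circle in
-- finitely many steps, so "v − u ∈ (0, 1)" is definable.  Composition of arcs, and
-- [r + 1, r + 2) = (r, r + 2) \ (r, r + 1), yield all arcs with integer ends relative to a
-- vertex, and a ⊕ z is what remains of (z − 1, z + 1) after removing (z − 1, z) and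
-- (z, z + 1).  A cyclic triple is recognised by rounding its three gaps up to integers, which
-- sum to less than 2L.

module Submission where

open import Defs
open import Axiom.ExcludedMiddle using (ExcludedMiddle)
open import Data.Integer.Base as ℤ using (ℤ; +_; -[1+_])
open import Data.Product.Base using (Σ; Σ-syntax; ∃; ∃-syntax; _×_; _,_; proj₁; proj₂)
open import Level using (0ℓ)
open import Relation.Binary.Definitions using (_Respects_; tri<; tri≈; tri>)
open import Relation.Unary using (Pred; _∩_)
open import Algebra.Bundles using (AbelianGroup)
open import Data.Bool.Base using (Bool; true; false; T) renaming (_∧_ to _∧ᵇ_)
open import Data.Bool.ListAction using (any)
open import Data.Bool.Properties using (T-∧)
open import Data.Empty using (⊥-elim)
open import Data.Fin.Base using (Fin; zero; suc; fromℕ; inject₁; _↑ˡ_; _↑ʳ_)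
open import Data.List.Base as List using (List; []; _∷_; _++_; concatMap)
open import Data.List.Relation.Unary.All as All using (All; []; _∷_)
import Data.List.Relation.Unary.All.Properties as All
open import Data.Nat.Base as ℕ using (ℕ; zero; suc)
open import Data.Sum.Base using (_⊎_; inj₁; inj₂; [_,_]′)
open import Data.Vec.Base as Vec using (Vec; []; _∷_; _∷ʳ_; lookup)
open import Data.Vec.Properties using (lookup-++ˡ; lookup-++ʳ)
open import Function.Base using (_∘_; id; case_of_)
open import Function.Bundles using (_⇔_; mk⇔; module Equivalence)
open import Function.Construct.Composition using (_⇔-∘_)
open import Function.Construct.Symmetry using (⇔-sym)
open import Relation.Binary.Bundles using (Setoid; TotalOrder)
open import Relation.Binary.Core using (Rel)
open import Relation.Binary.PropositionalEquality.Core as ≡ using (_≡_)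
open import Relation.Binary.Structures using (IsStrictTotalOrder)
open import Relation.Nullary using (¬_; Dec; yes; no; contradiction)
import Algebra.Construct.NaturalChoice.Max as Maximum
import Algebra.Construct.NaturalChoice.Min as Minimum
import Algebra.Properties.AbelianGroup as AbelianGroupProperties
import Algebra.Properties.CommutativeSemigroup as CommutativeSemigroupProperties

-- Linear arithmetic over the reals, proved by reflection.

module LinearArithmetic (ℝ : CompleteOrderedField) where
  open CompleteOrderedField ℝ hiding (zero)
  open RealLemmas ℝ
  open AbelianGroupProperties +-abelianGroup using (⁻¹-∙-comm; ε⁻¹≈ε)
  open CommutativeSemigroupProperties
    (AbelianGroup.commutativeSemigroup +-abelianGroup) using (interchange)
  private
    module < = IsStrictTotalOrder isStrictTotalOrder
    module ≤ = TotalOrder totalOrder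

    variable
      n : ℕ

  infix  8 :-_
  infixl 7 _:+_ _:-_
  infix  6 _:<_ _:≤_ _:≈_

  -- Constants such as 1 and L are variables as well, so every expression is a linear form with
  -- integer coefficients.
  data Expr (n : ℕ) : Set where
    var  : Fin n → Expr n
    :0   : Expr n
    _:+_ : Expr n → Expr n → Expr n
    :-_  : Expr n → Expr n

  _:-_ : Expr n → Expr n → Expr n
  a :- b = a :+ :- b

  data Constraint (n : ℕ) : Set where
    _:<_ _:≤_ _:≈_ : Expr n → Expr n → Constraint n

  ⟦_⟧ : Expr n → Vec Carrier n → Carrier
  ⟦ var i ⟧  ρ = lookup ρ i
  ⟦ :0 ⟧     ρ = 0#
  ⟦ a :+ b ⟧ ρ = ⟦ a ⟧ ρ + ⟦ b ⟧ ρ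
  ⟦ :- a ⟧   ρ = - ⟦ a ⟧ ρ

  ⟦_⟧ᶜ : Constraint n → Vec Carrier n → Set
  ⟦ a :< b ⟧ᶜ ρ = ⟦ a ⟧ ρ < ⟦ b ⟧ ρ
  ⟦ a :≤ b ⟧ᶜ ρ = ⟦ a ⟧ ρ ≤ ⟦ b ⟧ ρ
  ⟦ a :≈ b ⟧ᶜ ρ = ⟦ a ⟧ ρ ≈ ⟦ b ⟧ ρ

  Form : ℕ → Set
  Form = Vec ℤ

  value : Form n → Vec Carrier n → Carrier
  value []       []      = 0#
  value (c ∷ cs) (x ∷ ρ) = c · x + value cs ρ

  0ᶠ : Form n
  0ᶠ = Vec.replicate _ (+ 0)

  _+ᶠ_ : Form n → Form n → Form n
  _+ᶠ_ = Vec.zipWith ℤ._+_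

  unit : Fin n → Form n
  unit zero    = + 1 ∷ 0ᶠ
  unit (suc i) = + 0 ∷ unit i

  form : Expr n → Form n
  form (var i)  = unit i
  form :0       = 0ᶠ
  form (a :+ b) = form a +ᶠ form b
  form (:- a)   = Vec.map ℤ.-_ (form a)

  value-0ᶠ : (ρ : Vec Carrier n) → value 0ᶠ ρ ≈ 0#
  value-0ᶠ []      = refl
  value-0ᶠ (x ∷ ρ) = trans (+-identityˡ _) (value-0ᶠ ρ)

  value-unit : ∀ (ρ : Vec Carrier n) i → value (unit i) ρ ≈ lookup ρ i
  value-unit (x ∷ ρ) zero    =
    trans (+-cong (+-identityʳ x) (value-0ᶠ ρ)) (+-identityʳ x)
  value-unit (x ∷ ρ) (suc i) = trans (+-identityˡ _) (value-unit ρ i)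

  value-+ᶠ : ∀ (cs ds : Form n) ρ → value (cs +ᶠ ds) ρ ≈ value cs ρ + value ds ρ
  value-+ᶠ []       []       []      = sym (+-identityˡ 0#)
  value-+ᶠ (c ∷ cs) (d ∷ ds) (x ∷ ρ) =
    trans (+-cong (·-homo-+ c d x) (value-+ᶠ cs ds ρ)) (interchange _ _ _ _)

  value-neg : ∀ (cs : Form n) ρ → value (Vec.map ℤ.-_ cs) ρ ≈ - value cs ρ
  value-neg []       []      = sym ε⁻¹≈ε
  value-neg (c ∷ cs) (x ∷ ρ) =
    trans (+-cong (·-homo-neg c x) (value-neg cs ρ)) (⁻¹-∙-comm _ _)

  value-form : ∀ (a : Expr n) ρ → value (form a) ρ ≈ ⟦ a ⟧ ρ
  value-form (var i)  ρ = value-unit ρ i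
  value-form :0       ρ = value-0ᶠ ρ
  value-form (a :+ b) ρ =
    trans (value-+ᶠ (form a) (form b) ρ) (+-cong (value-form a ρ) (value-form b ρ))
  value-form (:- a)   ρ = trans (value-neg (form a) ρ) (-‿cong (value-form a ρ))

  -- Fourier-Motzkin elimination and its soundness.

  data Relation : Set where
    equal weak strict : Relation

  -- The relation to 0 that survives the addition of two facts: `equal` is neutral and `strict`
  -- absorbs.
  _⊓ʳ_ : Relation → Relation → Relation
  equal     ⊓ʳ t      = t
  s      ⊓ʳ equal     = s
  weak   ⊓ʳ t      = t
  strict ⊓ʳ _      = strict

  Positive : Relation → Carrier → Set
  Positive equal     x = 0# ≈ x
  Positive weak   x = 0# ≤ x
  Positive strict x = 0# < x

  Positive-resp-≈ : ∀ s {x y} → x ≈ y → Positive s x → Positive s y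
  Positive-resp-≈ equal     x≈y 0≈x = trans 0≈x x≈y
  Positive-resp-≈ weak   x≈y 0≤x = ≤.trans 0≤x (inj₂ x≈y)
  Positive-resp-≈ strict x≈y 0<x = <.<-respʳ-≈ x≈y 0<x

  +-mono-0≤ : ∀ {x y} → 0# ≤ x → y ≤ x + y
  +-mono-0≤ {x} {y} 0≤x = ≤.trans (inj₂ (sym (+-identityˡ y))) (+-monoˡ-≤ y 0≤x)

  +-mono-0< : ∀ {x y} → 0# < x → y < x + y
  +-mono-0< {x} {y} 0<x = <.<-respˡ-≈ (+-identityˡ y) (+-monoˡ-< y 0<x)

  Positive-+ : ∀ s t {x y} → Positive s x → Positive t y → Positive (s ⊓ʳ t) (x + y)
  Positive-+ equal     t      0≈x py  =
    Positive-resp-≈ t (trans (sym (+-identityˡ _)) (+-congʳ 0≈x)) py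
  Positive-+ weak   equal     0≤x 0≈y =
    ≤.trans 0≤x (inj₂ (trans (sym (+-identityʳ _)) (+-congˡ 0≈y)))
  Positive-+ strict equal     0<x 0≈y =
    <.<-respʳ-≈ (trans (sym (+-identityʳ _)) (+-congˡ 0≈y)) 0<x
  Positive-+ weak   weak   0≤x 0≤y = ≤.trans 0≤y (+-mono-0≤ 0≤x)
  Positive-+ weak   strict 0≤x 0<y = <-≤-trans 0<y (+-mono-0≤ 0≤x)
  Positive-+ strict weak   0<x 0≤y = ≤-<-trans 0≤y (+-mono-0< 0<x)
  Positive-+ strict strict 0<x 0<y = <.trans 0<y (+-mono-0< 0<x)

  Inequality : ℕ → Set
  Inequality n = Relation × Form n

  Holds : Vec Carrier n → Inequality n → Set
  Holds ρ (s , cs) = Positive s (value cs ρ)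

  _+ⁱ_ : Inequality n → Inequality n → Inequality n
  (s , cs) +ⁱ (t , ds) = (s ⊓ʳ t) , (cs +ᶠ ds)

  -- The sum has k + 1 copies of `p`, which fits the coefficients `+ suc a` and `-[1+ b ]`.
  multiple : ℕ → Inequality n → Inequality n
  multiple zero    p = p
  multiple (suc k) p = p +ⁱ multiple k p

  -- The head is tested for 0 here, which spares a proof that the combinations formed in `resolve`
  -- cancel the variable.
  dropHead : Inequality (suc n) → List (Inequality n)
  dropHead (s , + zero ∷ cs) = (s , cs) ∷ []
  dropHead _                 = []

  -- Taking b + 1 copies of one inequality and a + 1 of the other makes the leading coefficients
  -- opposite.
  resolve : Inequality (suc n) → Inequality (suc n) → List (Inequality n)
  resolve p@(_ , + suc a ∷ _)  q@(_ , -[1+ b ] ∷ _) = dropHead (multiple b p +ⁱ multiple a q)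
  resolve p@(_ , -[1+ a ] ∷ _) q@(_ , + suc b ∷ _)  = dropHead (multiple b p +ⁱ multiple a q)
  resolve _ _ = []

  -- An equation in which the variable occurs is solved for it: full Fourier–Motzkin
  -- elimination would only add redundant consequences.
  pivots : List (Inequality (suc n)) → List (Inequality (suc n))
  pivots []                              = []
  pivots ((equal , c@(+ suc _) ∷ cs)  ∷ ps) =
    (equal , c ∷ cs) ∷ (equal , Vec.map ℤ.-_ (c ∷ cs)) ∷ []
  pivots ((equal , c@(-[1+ _ ]) ∷ cs) ∷ ps) =
    (equal , c ∷ cs) ∷ (equal , Vec.map ℤ.-_ (c ∷ cs)) ∷ []
  pivots (_ ∷ ps)                        = pivots ps

  withPositiveHead : List (Inequality (suc n)) → List (Inequality (suc n))
  withPositiveHead []                           = []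
  withPositiveHead (p@(_ , + suc _ ∷ _) ∷ ps) = p ∷ withPositiveHead ps
  withPositiveHead (_ ∷ ps)                   = withPositiveHead ps

  -- Resolution needs opposite signs. An equation therefore comes with its negation, to meet
  -- constraints of either sign; in its absence every lower bound of the variable meets every upper
  -- bound.
  sources : List (Inequality (suc n)) → List (Inequality (suc n))
  sources ps with pivots ps
  ... | []       = withPositiveHead ps
  ... | qs@(_ ∷ _) = qs

  eliminate : List (Inequality (suc n)) → List (Inequality n)
  eliminate ps = concatMap dropHead ps ++ concatMap (λ p → concatMap (resolve p) ps) (sources ps)

  -- With no variables left the form has value 0, so only a strict inequality fails.
  contradictory : Inequality 0 → Bool
  contradictory (strict , _) = true
  contradictory _            = false

  refutable : ∀ n → List (Inequality n) → Bool
  refutable zero    ps = any contradictory ps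
  refutable (suc n) ps = refutable n (eliminate ps)

  Holds-+ⁱ : ∀ (ρ : Vec Carrier n) p q → Holds ρ p → Holds ρ q → Holds ρ (p +ⁱ q)
  Holds-+ⁱ ρ (s , cs) (t , ds) hp hq =
    Positive-resp-≈ (s ⊓ʳ t) (sym (value-+ᶠ cs ds ρ)) (Positive-+ s t hp hq)

  Holds-multiple : ∀ (ρ : Vec Carrier n) k p → Holds ρ p → Holds ρ (multiple k p)
  Holds-multiple ρ zero    p h = h
  Holds-multiple ρ (suc k) p h = Holds-+ⁱ ρ p (multiple k p) h (Holds-multiple ρ k p h)

  Holds-multiples : ∀ (ρ : Vec Carrier n) k l p q → Holds ρ p → Holds ρ q →
                    Holds ρ (multiple k p +ⁱ multiple l q)
  Holds-multiples ρ k l p q hp hq = Holds-+ⁱ ρ (multiple k p) (multiple l q)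
    (Holds-multiple ρ k p hp) (Holds-multiple ρ l q hq)

  Holds-dropHead : ∀ x (ρ : Vec Carrier n) p → Holds (x ∷ ρ) p → All (Holds ρ) (dropHead p)
  Holds-dropHead x ρ (s , + zero ∷ cs)   h = Positive-resp-≈ s (+-identityˡ _) h ∷ []
  Holds-dropHead x ρ (s , + suc a ∷ cs)  h = []
  Holds-dropHead x ρ (s , -[1+ b ] ∷ cs) h = []

  Holds-resolve : ∀ x (ρ : Vec Carrier n) p q → Holds (x ∷ ρ) p → Holds (x ∷ ρ) q →
                  All (Holds ρ) (resolve p q)
  Holds-resolve x ρ p@(_ , + suc a ∷ _)  q@(_ , -[1+ b ] ∷ _) hp hq =
    Holds-dropHead x ρ _ (Holds-multiples (x ∷ ρ) b a p q hp hq)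
  Holds-resolve x ρ p@(_ , -[1+ a ] ∷ _) q@(_ , + suc b ∷ _)  hp hq =
    Holds-dropHead x ρ _ (Holds-multiples (x ∷ ρ) b a p q hp hq)
  Holds-resolve x ρ (_ , + zero ∷ _)   _                  hp hq = []
  Holds-resolve x ρ (_ , + suc _ ∷ _)  (_ , + _ ∷ _)      hp hq = []
  Holds-resolve x ρ (_ , -[1+ _ ] ∷ _) (_ , + zero ∷ _)   hp hq = []
  Holds-resolve x ρ (_ , -[1+ _ ] ∷ _) (_ , -[1+ _ ] ∷ _) hp hq = []

  Holds-negation : ∀ (ρ : Vec Carrier n) cs → Holds ρ (equal , cs) → Holds ρ (equal , Vec.map ℤ.-_ cs)
  Holds-negation ρ cs 0≈v = trans (sym ε⁻¹≈ε) (trans (-‿cong 0≈v) (sym (value-neg cs ρ)))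

  Holds-pivots : ∀ (ρ : Vec Carrier (suc n)) ps → All (Holds ρ) ps → All (Holds ρ) (pivots ps)
  Holds-pivots ρ []                             hs       = []
  Holds-pivots ρ ((equal , + suc a ∷ cs)  ∷ ps)    (h ∷ hs) =
    h ∷ Holds-negation ρ (+ suc a ∷ cs) h ∷ []
  Holds-pivots ρ ((equal , -[1+ b ] ∷ cs) ∷ ps)    (h ∷ hs) =
    h ∷ Holds-negation ρ (-[1+ b ] ∷ cs) h ∷ []
  Holds-pivots ρ ((equal , + zero ∷ _)     ∷ ps)   (h ∷ hs) = Holds-pivots ρ ps hs
  Holds-pivots ρ ((weak , _)   ∷ ps)            (h ∷ hs) = Holds-pivots ρ ps hs
  Holds-pivots ρ ((strict , _) ∷ ps)            (h ∷ hs) = Holds-pivots ρ ps hs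

  Holds-withPositiveHead : ∀ (ρ : Vec Carrier (suc n)) ps → All (Holds ρ) ps →
                           All (Holds ρ) (withPositiveHead ps)
  Holds-withPositiveHead ρ []                          hs       = []
  Holds-withPositiveHead ρ ((_ , + suc _ ∷ _)  ∷ ps) (h ∷ hs) =
    h ∷ Holds-withPositiveHead ρ ps hs
  Holds-withPositiveHead ρ ((_ , + zero ∷ _)   ∷ ps) (h ∷ hs) = Holds-withPositiveHead ρ ps hs
  Holds-withPositiveHead ρ ((_ , -[1+ _ ] ∷ _) ∷ ps) (h ∷ hs) = Holds-withPositiveHead ρ ps hs

  Holds-sources : ∀ (ρ : Vec Carrier (suc n)) ps → All (Holds ρ) ps → All (Holds ρ) (sources ps)
  Holds-sources ρ ps hs with pivots ps | Holds-pivots ρ ps hs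
  ... | []    | _   = Holds-withPositiveHead ρ ps hs
  ... | _ ∷ _ | hs′ = hs′

  All-concatMap : ∀ {A B : Set} {P : Pred A 0ℓ} {Q : Pred B 0ℓ} (f : A → List B) →
                  (∀ {a} → P a → All Q (f a)) → ∀ {as} → All P as → All Q (concatMap f as)
  All-concatMap f f-All = All.concat⁺ ∘ All.map⁺ ∘ All.map f-All

  Holds-eliminate : ∀ x (ρ : Vec Carrier n) {ps} → All (Holds (x ∷ ρ)) ps →
                    All (Holds ρ) (eliminate ps)
  Holds-eliminate x ρ hs = All.++⁺
    (All-concatMap dropHead (λ {p} → Holds-dropHead x ρ p) hs)
    (All-concatMap _ (λ {p} hp → All-concatMap (resolve p) (λ {q} → Holds-resolve x ρ p q hp) hs)
      (Holds-sources (x ∷ ρ) _ hs))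

  refutable-sound : ∀ n ps → T (refutable n ps) → (ρ : Vec Carrier n) → ¬ All (Holds ρ) ps
  refutable-sound (suc n) ps r (x ∷ ρ) hs =
    refutable-sound n (eliminate ps) r ρ (Holds-eliminate x ρ hs)
  refutable-sound zero ((equal , [])     ∷ ps) r [] (h ∷ hs) = refutable-sound zero ps r [] hs
  refutable-sound zero ((weak , [])   ∷ ps) r [] (h ∷ hs) = refutable-sound zero ps r [] hs
  refutable-sound zero ((strict , []) ∷ ps) r [] (h ∷ hs) = <.irrefl refl h

  inequality : Relation → Expr n → Expr n → Inequality n
  inequality s a b = s , form (b :- a)

  Holds-equal : ∀ a b (ρ : Vec Carrier n) → ⟦ a ⟧ ρ ≈ ⟦ b ⟧ ρ → Holds ρ (inequality equal a b)
  Holds-equal a b ρ a≈b = trans (sym (-‿inverseʳ (⟦ a ⟧ ρ)))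
    (trans (+-congʳ a≈b) (sym (value-form (b :- a) ρ)))

  Holds-weak : ∀ a b (ρ : Vec Carrier n) → ⟦ a ⟧ ρ ≤ ⟦ b ⟧ ρ → Holds ρ (inequality weak a b)
  Holds-weak a b ρ a≤b = ≤.trans (inj₂ (sym (-‿inverseʳ (⟦ a ⟧ ρ))))
    (≤.trans (+-monoˡ-≤ (- ⟦ a ⟧ ρ) a≤b) (inj₂ (sym (value-form (b :- a) ρ))))

  Holds-strict : ∀ a b (ρ : Vec Carrier n) → ⟦ a ⟧ ρ < ⟦ b ⟧ ρ → Holds ρ (inequality strict a b)
  Holds-strict a b ρ a<b = <.<-respʳ-≈ (sym (value-form (b :- a) ρ))
    (<.<-respˡ-≈ (-‿inverseʳ (⟦ a ⟧ ρ)) (+-monoˡ-< (- ⟦ a ⟧ ρ) a<b))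

  fact : Constraint n → Inequality n
  fact (a :< b) = inequality strict a b
  fact (a :≤ b) = inequality weak a b
  fact (a :≈ b) = inequality equal a b

  Holds-fact : ∀ (ρ : Vec Carrier n) c → ⟦ c ⟧ᶜ ρ → Holds ρ (fact c)
  Holds-fact ρ (a :< b) = Holds-strict a b ρ
  Holds-fact ρ (a :≤ b) = Holds-weak a b ρ
  Holds-fact ρ (a :≈ b) = Holds-equal a b ρ

  refutes : List (Constraint n) → Constraint n → Bool
  refutes Γ c = refutable _ (List.map fact (c ∷ Γ))

  -- The negated goal is refuted, and trichotomy gives back the goal; an equation takes one
  -- refutation for each strict order.
  entails : List (Constraint n) → Constraint n → Bool
  entails Γ (a :< b) = refutes Γ (b :≤ a)
  entails Γ (a :≤ b) = refutes Γ (b :< a)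
  entails Γ (a :≈ b) = refutes Γ (a :< b) ∧ᵇ refutes Γ (b :< a)

  entails-sound : ∀ (Γ : List (Constraint n)) g → T (entails Γ g) →
                  ∀ ρ → All (λ c → ⟦ c ⟧ᶜ ρ) Γ → ⟦ g ⟧ᶜ ρ
  entails-sound Γ g e ρ hs = by g e
    where
    impossible : ∀ c → T (refutes Γ c) → ¬ ⟦ c ⟧ᶜ ρ
    impossible c r h = refutable-sound _ (List.map fact (c ∷ Γ)) r ρ
      (All.map⁺ (All.map (λ {c} → Holds-fact ρ c) (h ∷ hs)))

    by : ∀ g → T (entails Γ g) → ⟦ g ⟧ᶜ ρ
    by (a :< b) r with <.compare (⟦ a ⟧ ρ) (⟦ b ⟧ ρ)
    ... | tri< a<b _ _ = a<b
    ... | tri≈ _ a≈b _ = ⊥-elim (impossible (b :≤ a) r (inj₂ (sym a≈b)))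
    ... | tri> _ _ b<a = ⊥-elim (impossible (b :≤ a) r (inj₁ b<a))
    by (a :≤ b) r = ≮⇒≥ (impossible (b :< a) r)
    by (a :≈ b) r with Equivalence.to T-∧ r | <.compare (⟦ a ⟧ ρ) (⟦ b ⟧ ρ)
    ... | r₁ , _ | tri< a<b _ _ = ⊥-elim (impossible (a :< b) r₁ a<b)
    ... | _      | tri≈ _ a≈b _ = a≈b
    ... | _ , r₂ | tri> _ _ b<a = ⊥-elim (impossible (b :< a) r₂ b<a)

  -- Currying lets the proofs of the hypotheses be passed to `arith` as ordinary arguments.
  Sequent : Vec Carrier n → List (Constraint n) → Constraint n → Set
  Sequent ρ []      g = ⟦ g ⟧ᶜ ρ
  Sequent ρ (c ∷ Γ) g = ⟦ c ⟧ᶜ ρ → Sequent ρ Γ g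

  curryAll : ∀ (ρ : Vec Carrier n) Γ {g} → (All (λ c → ⟦ c ⟧ᶜ ρ) Γ → ⟦ g ⟧ᶜ ρ) → Sequent ρ Γ g
  curryAll ρ []      k = k []
  curryAll ρ (c ∷ Γ) k h = curryAll ρ Γ (k ∘ (h ∷_))

-- The circle described by real offsets between its points.

module CircleOffsets (em : ExcludedMiddle 0ℓ) (ℝ : CompleteOrderedField)
  (L : CompleteOrderedField.Carrier ℝ)
  (4<L : CompleteOrderedField._<_ ℝ (CompleteOrderedField.fromℤ ℝ (+ 4)) L)
  where

  open CompleteOrderedField ℝ hiding (zero)
  open RealLemmas ℝ
  open Circle em ℝ L (RealLemmas.4<x⇒2≤x ℝ 4<L)
  open LinearArithmetic ℝ
  open Minimum totalOrder using (x⊓y≤x; x⊓y≤y; ⊓-sel)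
  open Maximum totalOrder using (x≤x⊔y; x≤y⊔x; ⊔-sel)
  private
    module < = IsStrictTotalOrder isStrictTotalOrder
    module ≤ = TotalOrder totalOrder
    module 𝕊 = Setoid 𝕊
    variable
      n : ℕ

  -- The constants come last, so that they are eliminated last.
  :1 :4 :L : Expr (2 ℕ.+ n)
  :1 = var (fromℕ _)
  :4 = :1 :+ (:1 :+ (:1 :+ (:1 :+ :0)))
  :L = var (inject₁ (fromℕ _))

  :x₀ : Expr (3 ℕ.+ n)
  :x₀ = var zero
  :x₁ : Expr (4 ℕ.+ n)
  :x₁ = var (suc zero)
  :x₂ : Expr (5 ℕ.+ n)
  :x₂ = var (suc (suc zero))
  :x₃ : Expr (6 ℕ.+ n)
  :x₃ = var (suc (suc (suc zero)))
  :x₄ : Expr (7 ℕ.+ n)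
  :x₄ = var (suc (suc (suc (suc zero))))
  :x₅ : Expr (8 ℕ.+ n)
  :x₅ = var (suc (suc (suc (suc (suc zero)))))

  background : List (Constraint (2 ℕ.+ n))
  background = :0 :< :1 ∷ :4 :< :L ∷ []

  background-holds : ∀ (ρ : Vec Carrier n) → All (λ c → ⟦ c ⟧ᶜ (ρ ∷ʳ L ∷ʳ 1#)) background
  background-holds ρ = 0<1′ ρ ∷ 4<L′ ρ ∷ []
    where
    0<1′ : ∀ (ρ : Vec Carrier n) → ⟦ :0 :< :1 ⟧ᶜ (ρ ∷ʳ L ∷ʳ 1#)
    0<1′ []      = 0<1
    0<1′ (x ∷ ρ) = 0<1′ ρ

    4<L′ : ∀ (ρ : Vec Carrier n) → ⟦ :4 :< :L ⟧ᶜ (ρ ∷ʳ L ∷ʳ 1#)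
    4<L′ []      = 4<L
    4<L′ (x ∷ ρ) = 4<L′ ρ

  -- Once `entails` evaluates to `true`, the implicit argument has the unit type and is inferred, so
  -- each use is checked by computation.
  arith : ∀ (ρ : Vec Carrier n) Γ g {_ : T (entails (background ++ Γ) g)} →
          Sequent (ρ ∷ʳ L ∷ʳ 1#) Γ g
  arith ρ Γ g {e} = curryAll _ Γ {g}
    (entails-sound (background ++ Γ) g e _ ∘ All.++⁺ (background-holds ρ))

  -- The real t lifts the difference of the classes of b and a: it is the signed length of a way
  -- from a to b, fixed up to multiples of L.
  Offset : Carrier → Carrier → Pred Carrier 0ℓ
  Offset a b t = a + t ≋ b

  ≈⇒≋ : ∀ {a b} → a ≈ b → a ≋ b
  ≈⇒≋ a≈b = + 0 , trans a≈b (sym (+-identityʳ _))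

  +-cong-≋ : ∀ {a b} t → a ≋ b → a + t ≋ b + t
  +-cong-≋ {a} {b} t (k , a≈b+kL) = k ,
    arith (a ∷ b ∷ t ∷ k · L ∷ [])
      (:x₀ :≈ :x₁ :+ :x₃ ∷ []) (:x₀ :+ :x₂ :≈ :x₁ :+ :x₂ :+ :x₃) a≈b+kL

  offset-resp-≈ : ∀ {a b s t} → s ≈ t → Offset a b s → Offset a b t
  offset-resp-≈ s≈t = 𝕊.trans (≈⇒≋ (+-congˡ (sym s≈t)))

  offset-difference : ∀ a b → Offset a b (b - a)
  offset-difference a b = ≈⇒≋ (arith (a ∷ b ∷ []) [] (:x₀ :+ (:x₁ :- :x₀) :≈ :x₁))

  offset-zero : ∀ a → Offset a a 0#
  offset-zero a = ≈⇒≋ (+-identityʳ a)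

  offset-length : ∀ a → Offset a a L
  offset-length a = + 1 , +-congˡ (sym (+-identityʳ L))

  offset-trans : ∀ {a b c s t} → Offset a b s → Offset b c t → Offset a c (s + t)
  offset-trans {a} {s = s} {t} a+s≋b b+t≋c =
    𝕊.trans (≈⇒≋ (sym (+-assoc a s t))) (𝕊.trans (+-cong-≋ t a+s≋b) b+t≋c)

  offset-sym : ∀ {a b t} → Offset a b t → Offset b a (- t)
  offset-sym {a} {b} {t} a+t≋b = 𝕊.trans (+-cong-≋ (- t) (𝕊.sym a+t≋b)) (≈⇒≋ (x+y-y≈x a t))

  0≤n·x : ∀ {x} n → 0# ≤ x → 0# ≤ n ·ℕ x
  0≤n·x {x} zero    0≤x = inj₂ refl
  0≤n·x {x} (suc n) 0≤x =
    arith (x ∷ n ·ℕ x ∷ []) (:0 :≤ :x₀ ∷ :0 :≤ :x₁ ∷ []) (:0 :≤ :x₀ :+ :x₁) 0≤x (0≤n·x n 0≤x)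

  0≤n·1 : ∀ n → 0# ≤ n ·ℕ 1#
  0≤n·1 n = 0≤n·x n (inj₁ 0<1)

  0≤n·L : ∀ n → 0# ≤ n ·ℕ L
  0≤n·L n = 0≤n·x n (arith [] [] (:0 :≤ :L))

  small-multiple : ∀ k → k · L < L → - L < k · L → k · L ≈ 0#
  small-multiple (+ zero)  _ _ = refl
  small-multiple (+ suc n) h _ =
    arith (n ·ℕ L ∷ []) (:0 :≤ :x₀ ∷ :L :+ :x₀ :< :L ∷ []) (:L :+ :x₀ :≈ :0) (0≤n·L n) h
  small-multiple -[1+ n ]  _ h =
    arith (n ·ℕ L ∷ []) (:0 :≤ :x₀ ∷ :- :L :< :- (:L :+ :x₀) ∷ []) (:- (:L :+ :x₀) :≈ :0)
      (0≤n·L n) h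

  -- Two lifts of one difference differ by a multiple of L, and a multiple strictly between -L and L
  -- is 0.
  offset-unique : ∀ {a b s t} → Offset a b s → Offset a b t → s < t + L → t < s + L → s ≈ t
  offset-unique {a} {b} {s} {t} a+s≋b a+t≋b s<t+L t<s+L =
    let k , eq = 𝕊.trans a+s≋b (𝕊.sym a+t≋b)
        Γ = :x₀ :+ :x₁ :≈ :x₀ :+ :x₂ :+ :x₃ ∷ []
        kL<L  = arith (a ∷ s ∷ t ∷ k · L ∷ []) (:x₁ :< :x₂ :+ :L ∷ Γ) (:x₃ :< :L) s<t+L eq
        -L<kL = arith (a ∷ s ∷ t ∷ k · L ∷ []) (:x₂ :< :x₁ :+ :L ∷ Γ) (:- :L :< :x₃) t<s+L eq
    in arith (a ∷ s ∷ t ∷ k · L ∷ []) (:x₃ :≈ :0 ∷ Γ) (:x₁ :≈ :x₂)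
         (small-multiple k kL<L -L<kL) eq

  abstract
    -- The witness is the residue of b - a - r in [0, L), shifted back by r.
    offset-from : ∀ a b r → ∃[ t ] Offset a b t × r ≤ t × t < r + L
    offset-from a b r =
      let x = b - a - r
          0≤x , x<L = rep-bounds x
      in r + rep x ,
         𝕊.trans (𝕊.trans (≈⇒≋ (+-comm a _)) (+-cong-≋ a (𝕊.trans (≈⇒≋ (+-comm r _))
           (+-cong-≋ r (𝕊.sym (rep-≋ x))))))
           (≈⇒≋ (arith (a ∷ b ∷ r ∷ []) [] (:x₁ :- :x₀ :- :x₂ :+ :x₂ :+ :x₀ :≈ :x₁))) ,
         arith (r ∷ rep x ∷ []) (:0 :≤ :x₁ ∷ []) (:x₀ :≤ :x₀ :+ :x₁) 0≤x ,
         arith (r ∷ rep x ∷ []) (:x₁ :< :L ∷ []) (:x₀ :+ :x₁ :< :x₀ :+ :L) x<L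

  offset-rep : ∀ {a b t} → Offset a b t → Offset (rep a) (rep b) t
  offset-rep {a} {b} {t} o = 𝕊.trans (+-cong-≋ t (𝕊.sym (rep-≋ a))) (𝕊.trans o (rep-≋ b))

  offset-unrep : ∀ {a b t} → Offset (rep a) (rep b) t → Offset a b t
  offset-unrep {a} {b} {t} o = 𝕊.trans (+-cong-≋ t (rep-≋ a)) (𝕊.trans o (𝕊.sym (rep-≋ b)))

  infix 5 ⟨_,_⟩ [_,_] ⟨_,_]

  ⟨_,_⟩ [_,_] ⟨_,_] : Carrier → Carrier → Pred Carrier 0ℓ
  ⟨ r , s ⟩ t = r < t × t < s
  [ r , s ] t = r ≤ t × t ≤ s
  ⟨ r , s ] t = r < t × t ≤ s

  OffsetIn : Pred Carrier 0ℓ → Carrier → Carrier → Set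
  OffsetIn I a b = ∃[ t ] I t × Offset a b t

  -- The metric in terms of offsets.

  x≤∣x∣ : ∀ x → x ≤ ∣ x ∣
  x≤∣x∣ x = x≤x⊔y x (- x)

  -x≤∣x∣ : ∀ x → - x ≤ ∣ x ∣
  -x≤∣x∣ x = x≤y⊔x x (- x)

  chord : Carrier → Carrier → Carrier
  chord x y = ∣ x - y ∣ ⊓ (L - ∣ x - y ∣)

  InRange : Pred Carrier 0ℓ
  InRange x = 0# ≤ x × x < L

  -- If the minimum is the direct difference, y - x is the offset. Otherwise the short way crosses
  -- 0, and L is added or subtracted according to which of x and y is larger.
  chord<⇒offset : ∀ {x y r} → InRange x → InRange y → chord x y < r →
                  OffsetIn ⟨ - r , r ⟩ x y
  chord<⇒offset {x} {y} {r} (0≤x , x<L) (0≤y , y<L) d<r = by-cases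
    (⊓-sel ∣ x - y ∣ (L - ∣ x - y ∣)) (⊔-sel (x - y) (- (x - y)))
    where
    u = ∣ x - y ∣
    ρ = x ∷ y ∷ r ∷ u ∷ []

    by-cases : chord x y ≈ u ⊎ chord x y ≈ L - u → u ≈ x - y ⊎ u ≈ - (x - y) →
               OffsetIn ⟨ - r , r ⟩ x y
    by-cases (inj₁ d≈) _ =
      let h = <.<-respˡ-≈ d≈ d<r in y - x ,
        ( arith ρ (:x₃ :< :x₂ ∷ :x₀ :- :x₁ :≤ :x₃ ∷ [])
            (:- :x₂ :< :x₁ :- :x₀) h (x≤∣x∣ (x - y))
        , arith ρ (:x₃ :< :x₂ ∷ :- (:x₀ :- :x₁) :≤ :x₃ ∷ [])
            (:x₁ :- :x₀ :< :x₂) h (-x≤∣x∣ (x - y))) ,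
        offset-difference x y
    by-cases (inj₂ d≈) (inj₁ u≈) =
      let h = <.<-respˡ-≈ d≈ d<r in y - x + L ,
        ( arith ρ (:L :- :x₃ :< :x₂ ∷ :x₃ :≈ :x₀ :- :x₁ ∷ :x₀ :< :L ∷ :0 :≤ :x₁ ∷ [])
            (:- :x₂ :< :x₁ :- :x₀ :+ :L) h u≈ x<L 0≤y
        , arith ρ (:L :- :x₃ :< :x₂ ∷ :x₃ :≈ :x₀ :- :x₁ ∷ [])
            (:x₁ :- :x₀ :+ :L :< :x₂) h u≈) ,
        offset-trans (offset-difference x y) (offset-length y)
    by-cases (inj₂ d≈) (inj₂ u≈) =
      let h = <.<-respˡ-≈ d≈ d<r in y - x - L ,
        ( arith ρ (:L :- :x₃ :< :x₂ ∷ :x₃ :≈ :- (:x₀ :- :x₁) ∷ [])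
            (:- :x₂ :< :x₁ :- :x₀ :- :L) h u≈
        , arith ρ (:L :- :x₃ :< :x₂ ∷ :x₃ :≈ :- (:x₀ :- :x₁) ∷ :x₁ :< :L ∷ :0 :≤ :x₀ ∷ [])
            (:x₁ :- :x₀ :- :L :< :x₂) h u≈ y<L 0≤x) ,
        offset-trans (offset-difference x y) (offset-sym (offset-length y))

  L-∣x∣<r : ∀ {x r} → L - x < r ⊎ L + x < r → L - ∣ x ∣ < r
  L-∣x∣<r {x} {r} (inj₁ h) =
    arith (x ∷ r ∷ ∣ x ∣ ∷ []) (:L :- :x₀ :< :x₁ ∷ :x₀ :≤ :x₂ ∷ []) (:L :- :x₂ :< :x₁)
      h (x≤∣x∣ x)
  L-∣x∣<r {x} {r} (inj₂ h) =
    arith (x ∷ r ∷ ∣ x ∣ ∷ []) (:L :+ :x₀ :< :x₁ ∷ :- :x₀ :≤ :x₂ ∷ []) (:L :- :x₂ :< :x₁)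
      h (-x≤∣x∣ x)

  ∣x∣<r : ∀ {x r} → x < r → - x < r → ∣ x ∣ < r
  ∣x∣<r {x} x<r -x<r with ⊔-sel x (- x)
  ... | inj₁ m≈ = <.<-respˡ-≈ (sym m≈) x<r
  ... | inj₂ m≈ = <.<-respˡ-≈ (sym m≈) -x<r

  -- Both t and y - x lie in (-L, L), so they differ by 0, L or -L; the two comparisons tell which.
  offset⇒chord< : ∀ {x y r} → InRange x → InRange y → r ≤ L →
                  OffsetIn ⟨ - r , r ⟩ x y → chord x y < r
  offset⇒chord< {x} {y} {r} (0≤x , x<L) (0≤y , y<L) r≤L (t , (-r<t , t<r) , o) =
    by-cases (t <.<? (y - x + L)) ((y - x) <.<? (t + L))
    where
    ρ = x ∷ y ∷ t ∷ r ∷ []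

    by-cases : Dec (t < y - x + L) → Dec (y - x < t + L) → chord x y < r
    by-cases (yes t<) (yes <t) =
      let t≈ = offset-unique o (offset-difference x y) t< <t
      in ≤-<-trans (x⊓y≤x _ _) (∣x∣<r
           (arith ρ (:x₂ :≈ :x₁ :- :x₀ ∷ :- :x₃ :< :x₂ ∷ []) (:x₀ :- :x₁ :< :x₃) t≈ -r<t)
           (arith ρ (:x₂ :≈ :x₁ :- :x₀ ∷ :x₂ :< :x₃ ∷ []) (:- (:x₀ :- :x₁) :< :x₃) t≈ t<r))
    by-cases (no t≮) _ =
      let t≈ = offset-unique o (offset-trans (offset-difference x y) (offset-length y))
                 (arith ρ (:x₂ :< :x₃ ∷ :x₃ :≤ :L ∷ :0 :≤ :x₁ ∷ :x₀ :< :L ∷ [])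
                   (:x₂ :< (:x₁ :- :x₀ :+ :L) :+ :L) t<r r≤L 0≤y x<L)
                 (arith ρ (:x₁ :- :x₀ :+ :L :≤ :x₂ ∷ [])
                   (:x₁ :- :x₀ :+ :L :< :x₂ :+ :L) (≮⇒≥ t≮))
      in ≤-<-trans (x⊓y≤y _ _) (L-∣x∣<r (inj₁
           (arith ρ (:x₂ :≈ :x₁ :- :x₀ :+ :L ∷ :x₂ :< :x₃ ∷ []) (:L :- (:x₀ :- :x₁) :< :x₃)
             t≈ t<r)))
    by-cases _ (no ≮t) =
      let t≈ = offset-unique o
                 (offset-trans (offset-difference x y) (offset-sym (offset-length y)))
                 (arith ρ (:x₂ :+ :L :≤ :x₁ :- :x₀ ∷ [])
                   (:x₂ :< (:x₁ :- :x₀ :- :L) :+ :L) (≮⇒≥ ≮t))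
                 (arith ρ (:- :x₃ :< :x₂ ∷ :x₃ :≤ :L ∷ :0 :≤ :x₀ ∷ :x₁ :< :L ∷ [])
                   (:x₁ :- :x₀ :- :L :< :x₂ :+ :L) -r<t r≤L 0≤x y<L)
      in ≤-<-trans (x⊓y≤y _ _) (L-∣x∣<r (inj₂
           (arith ρ (:x₂ :≈ :x₁ :- :x₀ :- :L ∷ :- :x₃ :< :x₂ ∷ []) (:L :+ (:x₀ :- :x₁) :< :x₃)
             t≈ -r<t)))

  abstract
    d<⇒offset : ∀ a b r → d a b < r → OffsetIn ⟨ - r , r ⟩ a b
    d<⇒offset a b r d<r =
      let t , t∈ , o = chord<⇒offset (rep-bounds a) (rep-bounds b) d<r
      in t , t∈ , offset-unrep o

  abstract
    offset⇒d< : ∀ a b r → r ≤ L → OffsetIn ⟨ - r , r ⟩ a b → d a b < r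
    offset⇒d< a b r r≤L (t , t∈ , o) =
      offset⇒chord< (rep-bounds a) (rep-bounds b) r≤L (t , t∈ , offset-rep o)

  abstract
    midpoint : ∀ x y → ∃[ m ] m + m ≈ x + y
    midpoint x y =
      let ½ , 2½≈1 = inverse {1# + 1#} λ 2≈0 → <.irrefl refl
            (arith [] (:1 :+ :1 :≈ :0 ∷ []) (:0 :< :0) 2≈0)
          m = (x + y) * ½
      in m , trans (+-cong (*-comm _ _) (*-comm _ _)) (trans (sym (distribʳ (x + y) ½ ½))
               (trans (*-congʳ (trans (+-cong (sym (*-identityˡ ½)) (sym (*-identityˡ ½)))
                 (trans (sym (distribʳ ½ 1# 1#)) 2½≈1))) (*-identityˡ (x + y))))

  -- The circular order in terms of offsets.

  Ascending : Carrier → Carrier → Carrier → Set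
  Ascending x y z = (x < y × y < z) ⊎ (y < z × z < x) ⊎ (z < x × x < y)

  -- A form of the circular order that does not depend on the cut at 0: going up from a, one meets b
  -- and then c before a full turn is complete.
  UpwardTurn : Carrier → Carrier → Carrier → Set
  UpwardTurn a b c = ∃[ s ] ∃[ t ] (Offset a b s × Offset b c t) × 0# < s × 0# < t × s + t < L

  -- At most one of the gaps from x to y and from y to z passes 0, and L is added to that one.
  ascending⇒turn : ∀ {x y z} → InRange x → InRange y → InRange z →
                   Ascending x y z → UpwardTurn x y z
  ascending⇒turn {x} {y} {z} (0≤x , x<L) (0≤y , y<L) (0≤z , z<L) = by-cases
    where
    ρ = x ∷ y ∷ z ∷ []

    by-cases : Ascending x y z → UpwardTurn x y z
    by-cases (inj₁ (x<y , y<z)) = y - x , z - y ,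
      (offset-difference x y , offset-difference y z) ,
      arith ρ (:x₀ :< :x₁ ∷ []) (:0 :< :x₁ :- :x₀) x<y ,
      arith ρ (:x₁ :< :x₂ ∷ []) (:0 :< :x₂ :- :x₁) y<z ,
      arith ρ (:0 :≤ :x₀ ∷ :x₂ :< :L ∷ []) (:x₁ :- :x₀ :+ (:x₂ :- :x₁) :< :L) 0≤x z<L
    by-cases (inj₂ (inj₁ (y<z , z<x))) = y - x + L , z - y ,
      (offset-trans (offset-difference x y) (offset-length y) , offset-difference y z) ,
      arith ρ (:x₀ :< :L ∷ :0 :≤ :x₁ ∷ []) (:0 :< :x₁ :- :x₀ :+ :L) x<L 0≤y ,
      arith ρ (:x₁ :< :x₂ ∷ []) (:0 :< :x₂ :- :x₁) y<z ,
      arith ρ (:x₂ :< :x₀ ∷ []) (:x₁ :- :x₀ :+ :L :+ (:x₂ :- :x₁) :< :L) z<x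
    by-cases (inj₂ (inj₂ (z<x , x<y))) = y - x , z - y + L ,
      (offset-difference x y , offset-trans (offset-difference y z) (offset-length z)) ,
      arith ρ (:x₀ :< :x₁ ∷ []) (:0 :< :x₁ :- :x₀) x<y ,
      arith ρ (:x₁ :< :L ∷ :0 :≤ :x₂ ∷ []) (:0 :< :x₂ :- :x₁ :+ :L) y<L 0≤z ,
      arith ρ (:x₂ :< :x₀ ∷ []) (:x₁ :- :x₀ :+ (:x₂ :- :x₁ :+ :L) :< :L) z<x

  upward-offset : ∀ {x y t} → InRange x → InRange y → Offset x y t → 0# < t → t < L →
                  (x < y × t ≈ y - x) ⊎ t ≈ y - x + L
  upward-offset {x} {y} {t} (0≤x , x<L) (0≤y , y<L) o 0<t t<L = by-cases (x <.<? y)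
    where
    ρ = x ∷ y ∷ t ∷ []

    by-cases : Dec (x < y) → (x < y × t ≈ y - x) ⊎ t ≈ y - x + L
    by-cases (yes x<y) = inj₁ (x<y , offset-unique o (offset-difference x y)
      (arith ρ (:x₀ :< :x₁ ∷ :x₂ :< :L ∷ []) (:x₂ :< :x₁ :- :x₀ :+ :L) x<y t<L)
      (arith ρ (:0 :≤ :x₀ ∷ :x₁ :< :L ∷ :0 :< :x₂ ∷ []) (:x₁ :- :x₀ :< :x₂ :+ :L) 0≤x y<L 0<t))
    by-cases (no x≮y) = inj₂ (offset-unique o
      (offset-trans (offset-difference x y) (offset-length y))
      (arith ρ (:x₀ :< :L ∷ :0 :≤ :x₁ ∷ :x₂ :< :L ∷ []) (:x₂ :< :x₁ :- :x₀ :+ :L :+ :L)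
        x<L 0≤y t<L)
      (arith ρ (:x₁ :≤ :x₀ ∷ :0 :< :x₂ ∷ []) (:x₁ :- :x₀ :+ :L :< :x₂ :+ :L) (≮⇒≥ x≮y) 0<t))

  turn⇒ascending : ∀ {x y z} → InRange x → InRange y → InRange z →
                   UpwardTurn x y z → Ascending x y z
  turn⇒ascending {x} {y} {z} x∈@(0≤x , x<L) y∈ z∈@(0≤z , z<L)
                 (s , t , (o , o′) , 0<s , 0<t , s+t<L) = by-cases
    (upward-offset x∈ y∈ o 0<s
      (arith ρ (:0 :< :x₄ ∷ :x₃ :+ :x₄ :< :L ∷ []) (:x₃ :< :L) 0<t s+t<L))
    (upward-offset y∈ z∈ o′ 0<t
      (arith ρ (:0 :< :x₃ ∷ :x₃ :+ :x₄ :< :L ∷ []) (:x₄ :< :L) 0<s s+t<L))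
    where
    ρ = x ∷ y ∷ z ∷ s ∷ t ∷ []

    by-cases : (x < y × s ≈ y - x) ⊎ s ≈ y - x + L → (y < z × t ≈ z - y) ⊎ t ≈ z - y + L →
               Ascending x y z
    by-cases (inj₁ (x<y , _)) (inj₁ (y<z , _)) = inj₁ (x<y , y<z)
    by-cases (inj₂ s≈) (inj₁ (y<z , t≈)) = inj₂ (inj₁ (y<z ,
      arith ρ (:x₃ :≈ :x₁ :- :x₀ :+ :L ∷ :x₄ :≈ :x₂ :- :x₁ ∷ :x₃ :+ :x₄ :< :L ∷ [])
        (:x₂ :< :x₀) s≈ t≈ s+t<L))
    by-cases (inj₁ (x<y , s≈)) (inj₂ t≈) = inj₂ (inj₂ (
      arith ρ (:x₃ :≈ :x₁ :- :x₀ ∷ :x₄ :≈ :x₂ :- :x₁ :+ :L ∷ :x₃ :+ :x₄ :< :L ∷ [])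
        (:x₂ :< :x₀) s≈ t≈ s+t<L , x<y))
    -- If both gaps pass 0, they add up to z - x + 2L, which exceeds L.
    by-cases (inj₂ s≈) (inj₂ t≈) = ⊥-elim (<.irrefl refl
      (arith ρ (:x₃ :≈ :x₁ :- :x₀ :+ :L ∷ :x₄ :≈ :x₂ :- :x₁ :+ :L ∷ :x₃ :+ :x₄ :< :L ∷
                :x₀ :< :L ∷ :0 :≤ :x₂ ∷ []) (:0 :< :0) s≈ t≈ s+t<L x<L 0≤z))

  C⇔turn : ∀ {a b c} → C a b c ⇔ UpwardTurn a b c
  C⇔turn {a} {b} {c} = mk⇔
    (λ h → let s , t , (o , o′) , s+t = ascending⇒turn a∈ b∈ c∈ h
           in s , t , (offset-unrep o , offset-unrep o′) , s+t)
    (λ (s , t , (o , o′) , s+t) →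
      turn⇒ascending a∈ b∈ c∈ (s , t , (offset-rep o , offset-rep o′) , s+t))
    where
    a∈ = rep-bounds a
    b∈ = rep-bounds b
    c∈ = rep-bounds c

  -- The bound N drives the recursion; n < N later makes the choice of n a finite disjunction.
  floor : ∀ N x → 0# ≤ x → x < N ·ℕ 1# → ∃[ n ] n ℕ.< N × n ·ℕ 1# ≤ x × x < suc n ·ℕ 1#
  floor zero    x 0≤x x<0 = contradiction (≤-<-trans 0≤x x<0) (<.irrefl refl)
  floor (suc N) x 0≤x x<1+N with x <.<? 1#
  ... | yes x<1 = 0 , ℕ.z<s , 0≤x , arith (x ∷ []) (:x₀ :< :1 ∷ []) (:x₀ :< :1 :+ :0) x<1
  ... | no x≮1  =
    let n , n<N , n≤x-1 , x-1<1+n = floor N (x - 1#)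
          (arith (x ∷ []) (:1 :≤ :x₀ ∷ []) (:0 :≤ :x₀ :- :1) (≮⇒≥ x≮1))
          (arith (x ∷ N ·ℕ 1# ∷ []) (:x₀ :< :1 :+ :x₁ ∷ []) (:x₀ :- :1 :< :x₁) x<1+N)
        ρ = x ∷ n ·ℕ 1# ∷ []
    in suc n , ℕ.s<s n<N ,
       arith ρ (:x₁ :≤ :x₀ :- :1 ∷ []) (:1 :+ :x₁ :≤ :x₀) n≤x-1 ,
       arith ρ (:x₀ :- :1 :< :1 :+ :x₁ ∷ []) (:x₀ :< :1 :+ (:1 :+ :x₁)) x-1<1+n

  -- The inequality between l, m, n and L does not mention the points. What remains is a finite
  -- disjunction of conditions on arcs with integer ends.
  ArcsAround : ℕ → Carrier → Carrier → Carrier → Set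
  ArcsAround N x y z =
    ∃[ l ] l ℕ.< N × ∃[ m ] m ℕ.< N × ∃[ n ] n ℕ.< N ×
      suc l ·ℕ 1# + suc m ·ℕ 1# + suc n ·ℕ 1# < L + L ×
      OffsetIn ⟨ 0# , suc l ·ℕ 1# ⟩ x y ×
      OffsetIn ⟨ 0# , suc m ·ℕ 1# ⟩ y z ×
      OffsetIn ⟨ 0# , suc n ·ℕ 1# ⟩ z x

  -- Three upward arcs from x to y to z to x have total length a multiple of L; it is L
  -- itself if it is less than 2L.  Rounding the lengths up to integers adds at most 3 < L.
  turn⇔arcsAround : ∀ {N} → L < N ·ℕ 1# → ∀ {x y z} → UpwardTurn x y z ⇔ ArcsAround N x y z
  turn⇔arcsAround {N} L<N {x} {y} {z} = mk⇔ to from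
    where
    to : UpwardTurn x y z → ArcsAround N x y z
    to (s , t , (o , o′) , 0<s , 0<t , s+t<L) =
      let r = - (s + t) + L
          ρ = s ∷ t ∷ N ·ℕ 1# ∷ []
          :r = :- (:x₀ :+ :x₁) :+ :L
          0<r = arith ρ (:x₀ :+ :x₁ :< :L ∷ []) (:0 :< :r) s+t<L
          l , l<N , l≤s , s<1+l = floor N s (inj₁ 0<s)
            (arith ρ (:x₀ :+ :x₁ :< :L ∷ :0 :< :x₁ ∷ :L :< :x₂ ∷ []) (:x₀ :< :x₂) s+t<L 0<t L<N)
          m , m<N , m≤t , t<1+m = floor N t (inj₁ 0<t)
            (arith ρ (:x₀ :+ :x₁ :< :L ∷ :0 :< :x₀ ∷ :L :< :x₂ ∷ []) (:x₁ :< :x₂) s+t<L 0<s L<N)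
          n , n<N , n≤r , r<1+n = floor N r (inj₁ 0<r)
            (arith ρ (:0 :< :x₀ ∷ :0 :< :x₁ ∷ :L :< :x₂ ∷ []) (:r :< :x₂) 0<s 0<t L<N)
      in l , l<N , m , m<N , n , n<N ,
         arith (s ∷ t ∷ l ·ℕ 1# ∷ m ·ℕ 1# ∷ n ·ℕ 1# ∷ [])
           (:x₂ :≤ :x₀ ∷ :x₃ :≤ :x₁ ∷ :x₄ :≤ :- (:x₀ :+ :x₁) :+ :L ∷ [])
           (:1 :+ :x₂ :+ (:1 :+ :x₃) :+ (:1 :+ :x₄) :< :L :+ :L) l≤s m≤t n≤r ,
         (s , (0<s , s<1+l) , o) , (t , (0<t , t<1+m) , o′) ,
         (r , (0<r , r<1+n) , offset-trans (offset-sym (offset-trans o o′)) (offset-length x))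

    from : ArcsAround N x y z → UpwardTurn x y z
    from (l , _ , m , _ , n , _ , l+m+n<2L ,
          (s , (0<s , s<l) , o) , (t , (0<t , t<m) , o′) , (r , (0<r , r<n) , o″)) =
      let ρ = s ∷ t ∷ r ∷ []
          s+t+r≈L = offset-unique (offset-trans (offset-trans o o′) o″) (offset-length x)
            (arith (s ∷ t ∷ r ∷ suc l ·ℕ 1# ∷ suc m ·ℕ 1# ∷ suc n ·ℕ 1# ∷ [])
              (:x₀ :< :x₃ ∷ :x₁ :< :x₄ ∷ :x₂ :< :x₅ ∷ :x₃ :+ :x₄ :+ :x₅ :< :L :+ :L ∷ [])
              (:x₀ :+ :x₁ :+ :x₂ :< :L :+ :L) s<l t<m r<n l+m+n<2L)
            (arith ρ (:0 :< :x₀ ∷ :0 :< :x₁ ∷ :0 :< :x₂ ∷ []) (:L :< :x₀ :+ :x₁ :+ :x₂ :+ :L)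
              0<s 0<t 0<r)
      in s , t , (o , o′) , 0<s , 0<t ,
         arith ρ (:x₀ :+ :x₁ :+ :x₂ :≈ :L ∷ :0 :< :x₂ ∷ []) (:x₀ :+ :x₁ :< :L) s+t+r≈L 0<r

  fromℤ-minus : ∀ z t → fromℤ (z ℤ.- t) ≈ fromℤ z - fromℤ t
  fromℤ-minus z t = trans (·-homo-+ z (ℤ.- t) 1#) (+-congˡ (·-homo-neg t 1#))

  offset-translate : ∀ a b z t s →
    Offset (a ⊕ z) (b ⊕ t) s ⇔ Offset a b (fromℤ (z ℤ.- t) + s)
  offset-translate a b z t s = mk⇔
    (λ o → 𝕊.trans
      (≈⇒≋ (arith ρ (:x₅ :≈ :x₂ :- :x₃ ∷ []) (:x₀ :+ (:x₅ :+ :x₄) :≈ :x₀ :+ :x₂ :+ :x₄ :- :x₃)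
        (fromℤ-minus z t)))
      (𝕊.trans (+-cong-≋ (- fromℤ t) o) (≈⇒≋ (x+y-y≈x b (fromℤ t)))))
    (λ o → 𝕊.trans
      (≈⇒≋ (arith ρ (:x₅ :≈ :x₂ :- :x₃ ∷ []) (:x₀ :+ :x₂ :+ :x₄ :≈ :x₀ :+ (:x₅ :+ :x₄) :+ :x₃)
        (fromℤ-minus z t)))
      (+-cong-≋ (fromℤ t) o))
    where
    ρ = a ∷ b ∷ fromℤ z ∷ fromℤ t ∷ s ∷ fromℤ (z ℤ.- t) ∷ []

  -- The translates a ⊕ z and b ⊕ t need not be vertices; shifting the ends of the arc instead
  -- leaves a condition on a and b themselves.
  offsetIn-translate : ∀ a b z t r →
    OffsetIn ⟨ fromℤ (z ℤ.- t) , fromℤ (z ℤ.- t) + r ⟩ a b ⇔ OffsetIn ⟨ 0# , r ⟩ (a ⊕ z) (b ⊕ t)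
  offsetIn-translate a b z t r = mk⇔
    (λ (s , (<s , s<) , o) → s - D ,
      ( arith (D ∷ r ∷ s ∷ []) (:x₀ :< :x₂ ∷ []) (:0 :< :x₂ :- :x₀) <s
      , arith (D ∷ r ∷ s ∷ []) (:x₂ :< :x₀ :+ :x₁ ∷ []) (:x₂ :- :x₀ :< :x₁) s< ) ,
      Equivalence.from (offset-translate a b z t (s - D))
        (offset-resp-≈ (arith (D ∷ s ∷ []) [] (:x₁ :≈ :x₀ :+ (:x₁ :- :x₀))) o))
    (λ (s , (<s , s<) , o) → D + s ,
      ( arith (D ∷ r ∷ s ∷ []) (:0 :< :x₂ ∷ []) (:x₀ :< :x₀ :+ :x₂) <s
      , arith (D ∷ r ∷ s ∷ []) (:x₂ :< :x₁ ∷ []) (:x₀ :+ :x₂ :< :x₀ :+ :x₁) s< ) ,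
      Equivalence.to (offset-translate a b z t s) o)
    where
    D = fromℤ (z ℤ.- t)

-- Combinators for definability over fixed parameters.

module DefinabilityFrom {V : Setoid 0ℓ 0ℓ} (G : SimpleGraph V)
                        {m : ℕ} (ps : Vec (Setoid.Carrier V) m) where
  open Setoid V using (_≈_) renaming (Carrier to Vertex)
  open SimpleGraph G using (_—_)
  open Definability G
  open Equivalence

  private
    variable
      n : ℕ
      P Q : Pred (Vec Vertex n) 0ℓ

  -- The parameters are fixed once, so that formulas combine without merging parameter lists.
  Def : Pred (Vec Vertex n) 0ℓ → Set
  Def {n} P = Σ (Formula (n ℕ.+ m)) λ φ → ∀ vs → (vs Vec.++ ps ⊨ φ) ⇔ P vs

  -- A formula is supplied for any two variables of any context, so relations can be used under
  -- quantifiers without renaming.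
  Def₂ : Rel Vertex 0ℓ → Set
  Def₂ R = ∀ {n} (i j : Fin n) → Def (λ vs → R (lookup vs i) (lookup vs j))

  Def₃ : (Vertex → Vertex → Vertex → Set) → Set
  Def₃ R = ∀ {n} (i j k : Fin n) → Def (λ vs → R (lookup vs i) (lookup vs j) (lookup vs k))

  definable : Def P → Definable P
  definable (φ , sem) = m , φ , ps , sem

  infixr 7 _∧ᵈ_
  infixr 5 _⇒ᵈ_

  mapᵈ : (∀ vs → P vs ⇔ Q vs) → Def P → Def Q
  mapᵈ P⇔Q (φ , sem) = φ , λ vs →
    mk⇔ (to (P⇔Q vs) ∘ to (sem vs)) (from (sem vs) ∘ from (P⇔Q vs))

  map₂ : ∀ {R R′ : Rel Vertex 0ℓ} → (∀ u v → R u v ⇔ R′ u v) → Def₂ R → Def₂ R′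
  map₂ R⇔R′ def i j = mapᵈ (λ vs → R⇔R′ (lookup vs i) (lookup vs j)) (def i j)

  adjacentᵈ : Def₂ _—_
  adjacentᵈ i j = (i ↑ˡ m) ∼ (j ↑ˡ m) , λ vs →
    mk⇔ (≡.subst₂ _—_ (lookup-++ˡ vs ps i) (lookup-++ˡ vs ps j))
        (≡.subst₂ _—_ (≡.sym (lookup-++ˡ vs ps i)) (≡.sym (lookup-++ˡ vs ps j)))

  parameterᵈ : ∀ (k : Fin m) (i : Fin n) → Def (λ vs → lookup vs i ≈ lookup ps k)
  parameterᵈ {n} k i = (i ↑ˡ m) ≐ (n ↑ʳ k) , λ vs →
    mk⇔ (≡.subst₂ _≈_ (lookup-++ˡ vs ps i) (lookup-++ʳ vs ps k))
        (≡.subst₂ _≈_ (≡.sym (lookup-++ˡ vs ps i)) (≡.sym (lookup-++ʳ vs ps k)))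

  _∧ᵈ_ : Def P → Def Q → Def (P ∩ Q)
  (φ , semφ) ∧ᵈ (ψ , semψ) = φ ∧ ψ , λ vs →
    mk⇔ (λ (p , q) → to (semφ vs) p , to (semψ vs) q)
        (λ (p , q) → from (semφ vs) p , from (semψ vs) q)

  _⇒ᵈ_ : Def P → Def Q → Def (λ vs → P vs → Q vs)
  (φ , semφ) ⇒ᵈ (ψ , semψ) = φ ⇒ ψ , λ vs →
    mk⇔ (λ f p → to (semψ vs) (f (from (semφ vs) p)))
        (λ f p → from (semψ vs) (f (to (semφ vs) p)))

  ¬ᵈ_ : Def P → Def (λ vs → ¬ P vs)
  ¬ᵈ (φ , sem) = neg φ , λ vs → mk⇔ (λ ¬p p → ¬p (from (sem vs) p)) (λ ¬p p → ¬p (to (sem vs) p))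

  ∀ᵈ : {P : Pred (Vec Vertex (suc n)) 0ℓ} → Def P → Def (λ vs → ∀ v → P (v ∷ vs))
  ∀ᵈ (φ , sem) = all φ , λ vs →
    mk⇔ (λ f v → to (sem (v ∷ vs)) (f v)) (λ f v → from (sem (v ∷ vs)) (f v))

  ∃ᵈ : {P : Pred (Vec Vertex (suc n)) 0ℓ} → Def P → Def (λ vs → ∃[ v ] P (v ∷ vs))
  ∃ᵈ (φ , sem) = ex φ , λ vs →
    mk⇔ (λ (v , p) → v , to (sem (v ∷ vs)) p) (λ (v , p) → v , from (sem (v ∷ vs)) p)

  constantᵈ : ∀ {A : Set} → Dec A → Def {n} (λ _ → A)
  constantᵈ (yes a) = neg ff , λ _ → mk⇔ (λ _ → a) (λ _ → id)
  constantᵈ (no ¬a) = ff , λ _ → mk⇔ ⊥-elim ¬a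

  -- Formulas quantify over vertices only; a bounded choice of a number is unfolded into a
  -- disjunction.
  ∃<ᵈ : ∀ {P : ℕ → Pred (Vec Vertex n) 0ℓ} N → (∀ k → Def (P k)) →
        Def (λ vs → ∃[ k ] k ℕ.< N × P k vs)
  ∃<ᵈ zero    def = ff , λ _ → mk⇔ ⊥-elim λ ()
  ∃<ᵈ {P = P} (suc N) def =
    let φ , semφ = def 0
        ψ , semψ = ∃<ᵈ N (def ∘ suc)
    in φ ∨ ψ , λ vs → mk⇔
         [ (λ p → 0 , ℕ.z<s , to (semφ vs) p)
         , (λ p → let k , k<N , q = to (semψ vs) p in suc k , ℕ.s<s k<N , q) ]′
         λ { (zero , _ , p) → inj₁ (from (semφ vs) p)
           ; (suc k , ℕ.s<s k<N , p) → inj₂ (from (semψ vs) (k , k<N , p)) }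

-- Vertices in prescribed arcs.

module GECGraph (em : ExcludedMiddle 0ℓ) (ℝ : CompleteOrderedField)
  (L : CompleteOrderedField.Carrier ℝ)
  (4<L : CompleteOrderedField._<_ ℝ (CompleteOrderedField.fromℤ ℝ (+ 4)) L)
  (S : Pred (CompleteOrderedField.Carrier ℝ) 0ℓ)
  (S-dense : Circle.Dense em ℝ L (RealLemmas.4<x⇒2≤x ℝ 4<L) S)
  (G : SimpleGraph (Circle.Subspace em ℝ L (RealLemmas.4<x⇒2≤x ℝ 4<L) S))
  (gec : Circle.GeometricallyExistentiallyClosed em ℝ L (RealLemmas.4<x⇒2≤x ℝ 4<L) S G)
  where

  open CompleteOrderedField ℝ hiding (zero)
  open RealLemmas ℝ
  open Circle em ℝ L (RealLemmas.4<x⇒2≤x ℝ 4<L)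
  open LinearArithmetic ℝ
  open CircleOffsets em ℝ L 4<L
  open SimpleGraph G using (_—_) renaming (sym to —-sym)
  open GeometricallyExistentiallyClosed gec
  private
    module < = IsStrictTotalOrder isStrictTotalOrder
    module ≤ = TotalOrder totalOrder
    module 𝕊 = Setoid 𝕊

  Vertex : Set
  Vertex = ∃ S

  -- Going up from u by some length in I leads to v.
  Within : Pred Carrier 0ℓ → Rel Vertex 0ℓ
  Within I u v = OffsetIn I (proj₁ u) (proj₁ v)

  abstract
    dense : ∀ x {ε} → 0# < ε → Σ[ v ∈ Vertex ] d x (proj₁ v) < ε
    dense x 0<ε = let v , v∈S , h = S-dense x 0<ε in (v , v∈S) , h

  abstract
    -- For the midpoint m of r and s, the ball of radius s - m around a + m reaches from a + r to a
    -- + s, because m - (s - m) = r.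
    vertexIn : ∀ a {r s} → r < s → Σ[ v ∈ Vertex ] OffsetIn ⟨ r , s ⟩ a (proj₁ v)
    vertexIn a {r} {s} r<s =
      let m , 2m≈r+s  = midpoint r s
          v , h = dense (a + m)
            (arith (r ∷ s ∷ m ∷ []) (:x₂ :+ :x₂ :≈ :x₀ :+ :x₁ ∷ :x₀ :< :x₁ ∷ [])
              (:0 :< :x₁ :- :x₂) 2m≈r+s r<s)
          t , (<t , t<) , o = d<⇒offset (a + m) (proj₁ v) (s - m) h
          ρ = r ∷ s ∷ m ∷ t ∷ []
      in v , m + t ,
         ( arith ρ (:x₂ :+ :x₂ :≈ :x₀ :+ :x₁ ∷ :- (:x₁ :- :x₂) :< :x₃ ∷ []) (:x₀ :< :x₂ :+ :x₃)
             2m≈r+s <t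
         , arith ρ (:x₃ :< :x₁ :- :x₂ ∷ []) (:x₂ :+ :x₃ :< :x₁) t< ) ,
         offset-trans 𝕊.refl o

  abstract
    -- The four inequalities say that the larger lower end is below the smaller upper end; the cases
    -- select these two ends.
    vertexIn₂ : ∀ a {r r′ s s′} → r < s → r < s′ → r′ < s → r′ < s′ →
                Σ[ v ∈ Vertex ] OffsetIn (⟨ r , s ⟩ ∩ ⟨ r′ , s′ ⟩) a (proj₁ v)
    vertexIn₂ a {r} {r′} {s} {s′} r<s r<s′ r′<s r′<s′ = by-cases (≤.total r r′) (≤.total s s′)
      where
      by-cases : r ≤ r′ ⊎ r′ ≤ r → s ≤ s′ ⊎ s′ ≤ s →
                 Σ[ v ∈ Vertex ] OffsetIn (⟨ r , s ⟩ ∩ ⟨ r′ , s′ ⟩) a (proj₁ v)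
      by-cases (inj₁ r≤r′) (inj₁ s≤s′) =
        let v , t , (<t , t<) , o = vertexIn a r′<s
        in v , t , ((≤-<-trans r≤r′ <t , t<) , <t , <-≤-trans t< s≤s′) , o
      by-cases (inj₁ r≤r′) (inj₂ s′≤s) =
        let v , t , (<t , t<) , o = vertexIn a r′<s′
        in v , t , ((≤-<-trans r≤r′ <t , <-≤-trans t< s′≤s) , <t , t<) , o
      by-cases (inj₂ r′≤r) (inj₁ s≤s′) =
        let v , t , (<t , t<) , o = vertexIn a r<s
        in v , t , ((<t , t<) , ≤-<-trans r′≤r <t , <-≤-trans t< s≤s′) , o
      by-cases (inj₂ r′≤r) (inj₂ s′≤s) =
        let v , t , (<t , t<) , o = vertexIn a r<s′
        in v , t , ((<t , <-≤-trans t< s′≤s) , ≤-<-trans r′≤r <t , t<) , o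

  2# : Carrier
  2# = 1# + 1#

  1≤L : 1# ≤ L
  1≤L = arith [] [] (:1 :≤ :L)

  adjacent⇒within-1 : ∀ {u v} → u — v → Within ⟨ - 1# , 1# ⟩ u v
  adjacent⇒within-1 {u} {v} u—v = d<⇒offset (proj₁ u) (proj₁ v) 1# (adjacent⇒d<1 {u} {v} u—v)

  -- This is the extension property with B empty, its balls read as arcs.
  extend : ∀ c as → All (Within ⟨ - 1# , 1# ⟩ c) as → ∀ {ε} → 0# < ε →
           ∃[ v ] Within ⟨ - ε , ε ⟩ c v × All (v —_) as
  extend c as near {ε} 0<ε =
    let v , _ , _ , d<ε , v—as , _ = extension c as [] (λ { (_ , ()) })
          (All.map (λ {a} → offset⇒d< (proj₁ c) (proj₁ a) 1# 1≤L) near) [] 0<ε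
    in v , d<⇒offset (proj₁ c) (proj₁ v) ε d<ε , v—as

  <-≤-total : ∀ x y → x < y ⊎ y ≤ x
  <-≤-total x y = [ (λ x≤y → [ inj₁ , inj₂ ∘ inj₂ ∘ sym ]′ x≤y) , inj₂ ]′ (≤.total x y)

  ≤-<-total : ∀ x y → x ≤ y ⊎ y < x
  ≤-<-total x y = [ inj₂ , inj₁ ]′ (<-≤-total y x)

  0<y-x : ∀ {x y} → x < y → 0# < y - x
  0<y-x {x} {y} = arith (x ∷ y ∷ []) (:x₀ :< :x₁ ∷ []) (:0 :< :x₁ :- :x₀)

  positive-below : ∀ {x y} → 0# < x → 0# < y → ∃[ ε ] 0# < ε × ε ≤ x × ε ≤ y
  positive-below {x} {y} 0<x 0<y =
    [ (λ x≤y → x , 0<x , ≤.refl , x≤y) , (λ y≤x → y , 0<y , y≤x , ≤.refl) ]′ (≤.total x y)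

  -- Distances and sides recognised from adjacency.

  abstract
    -- Extension is applied at a vertex c of the arc, whose unit ball contains u, with ε at most the
    -- distance from c to either end of the arc.
    neighbourIn : ∀ u {r s} → - 1# ≤ r → r < s → s ≤ 1# → ∃[ v ] v — u × Within ⟨ r , s ⟩ u v
    neighbourIn u {r} {s} -1≤r r<s s≤1 =
      case vertexIn (proj₁ u) r<s of λ { (c , t , (r<t , t<s) , o) →
      case positive-below (0<y-x r<t) (0<y-x t<s) of λ { (ε , 0<ε , ε≤t-r , ε≤s-t) →
      case extend c (u ∷ []) ((- t ,
             ( arith (s ∷ t ∷ []) (:x₁ :< :x₀ ∷ :x₀ :≤ :1 ∷ []) (:- :1 :< :- :x₁) t<s s≤1
             , arith (r ∷ t ∷ []) (:x₀ :< :x₁ ∷ :- :1 :≤ :x₀ ∷ []) (:- :x₁ :< :1) r<t -1≤r ) ,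
             offset-sym o) ∷ []) 0<ε of λ { (v , (t′ , (<t′ , t′<) , o′) , v—u ∷ []) →
      v , v—u , t + t′ ,
      ( arith (r ∷ t ∷ t′ ∷ ε ∷ []) (:x₃ :≤ :x₁ :- :x₀ ∷ :- :x₃ :< :x₂ ∷ []) (:x₀ :< :x₁ :+ :x₂)
          ε≤t-r <t′
      , arith (s ∷ t ∷ t′ ∷ ε ∷ []) (:x₃ :≤ :x₀ :- :x₁ ∷ :x₂ :< :x₃ ∷ []) (:x₁ :+ :x₂ :< :x₀)
          ε≤s-t t′< ) ,
      offset-trans o o′ } } }

  abstract
    -- Two edges span less than 2. Conversely the unit arcs around u and v overlap, and extension at
    -- a vertex c of the overlap gives a neighbour of both.
    common-neighbour⇔ : ∀ u v → (∃[ w ] u — w × w — v) ⇔ Within ⟨ - 2# , 2# ⟩ u v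
    common-neighbour⇔ u v = mk⇔ to from
      where
      to : (∃[ w ] u — w × w — v) → Within ⟨ - 2# , 2# ⟩ u v
      to (w , u—w , w—v) = concat (adjacent⇒within-1 {u} {w} u—w) (adjacent⇒within-1 {w} {v} w—v)
        where
        concat : Within ⟨ - 1# , 1# ⟩ u w → Within ⟨ - 1# , 1# ⟩ w v → Within ⟨ - 2# , 2# ⟩ u v
        concat (s , (<s , s<) , o) (t , (<t , t<) , o′) = s + t ,
          ( arith (s ∷ t ∷ []) (:- :1 :< :x₀ ∷ :- :1 :< :x₁ ∷ []) (:- (:1 :+ :1) :< :x₀ :+ :x₁)
              <s <t
          , arith (s ∷ t ∷ []) (:x₀ :< :1 ∷ :x₁ :< :1 ∷ []) (:x₀ :+ :x₁ :< :1 :+ :1) s< t< ) ,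
          offset-trans o o′

      from : Within ⟨ - 2# , 2# ⟩ u v → ∃[ w ] u — w × w — v
      from (t , (<t , t<) , o) =
        case vertexIn₂ (proj₁ u) { - 1#} {t - 1#} {1#} {t + 1#}
               (arith [] [] (:- :1 :< :1))
               (arith (t ∷ []) (:- (:1 :+ :1) :< :x₀ ∷ []) (:- :1 :< :x₀ :+ :1) <t)
               (arith (t ∷ []) (:x₀ :< :1 :+ :1 ∷ []) (:x₀ :- :1 :< :1) t<)
               (arith (t ∷ []) [] (:x₀ :- :1 :< :x₀ :+ :1))
        of λ { (c , s , ((<s , s<) , (<s′ , s<′)) , o′) →
        case extend c (u ∷ v ∷ [])
          ( (- s ,
              ( arith (s ∷ []) (:x₀ :< :1 ∷ []) (:- :1 :< :- :x₀) s<
              , arith (s ∷ []) (:- :1 :< :x₀ ∷ []) (:- :x₀ :< :1) <s ) , offset-sym o′)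
          ∷ (- s + t ,
              ( arith (t ∷ s ∷ []) (:x₁ :< :x₀ :+ :1 ∷ []) (:- :1 :< :- :x₁ :+ :x₀) s<′
              , arith (t ∷ s ∷ []) (:x₀ :- :1 :< :x₁ ∷ []) (:- :x₁ :+ :x₀ :< :1) <s′ ) ,
              offset-trans (offset-sym o′) o)
          ∷ []) 0<1
        of λ { (w , _ , w—u ∷ w—v ∷ []) → w , —-sym w—u , w—v } }

  Near : Rel Vertex 0ℓ
  Near = Within [ - 1# , 1# ]

  -- The open unit ball around v lies in the open ball of radius 2 around u iff u and v
  -- are at distance at most 1.  The room for a violation beyond is L − 4.
  abstract
    neighbours-within-2⇔near : ∀ u v → (∀ w → w — v → Within ⟨ - 2# , 2# ⟩ w u) ⇔ Near u v
    neighbours-within-2⇔near u v = mk⇔ to from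
      where
      from : Near u v → ∀ w → w — v → Within ⟨ - 2# , 2# ⟩ w u
      from (t , (<t , t<) , o) w w—v =
        let s , (<s , s<) , o′ = adjacent⇒within-1 {w} {v} w—v
            ρ = t ∷ s ∷ []
        in s - t ,
           ( arith ρ (:x₀ :≤ :1 ∷ :- :1 :< :x₁ ∷ []) (:- (:1 :+ :1) :< :x₁ :- :x₀) t< <s
           , arith ρ (:- :1 :≤ :x₀ ∷ :x₁ :< :1 ∷ []) (:x₁ :- :x₀ :< :1 :+ :1) <t s< ) ,
           offset-trans o′ (offset-sym o)

      to : (∀ w → w — v → Within ⟨ - 2# , 2# ⟩ w u) → Near u v
      to h = by-cases (offset-from (proj₁ u) (proj₁ v) 0#)
        where
        far : ∀ {t} → Offset (proj₁ u) (proj₁ v) t → 1# < t → t < L - 1# → Near u v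
        far {t} o 1<t t<L-1 =
          -- Here r = max(-1, 2 - t) and s = min(1, L - 2 - t), so that a neighbour of v at offset
          -- in (r, s) is at least 2 away from u both ways round. That r < s uses 1 < t < L - 1 and
          -- L > 4.
          case lower (≤.total (- 1#) (2# - t)) of λ { (r , -1≤r , 2≤t+r , r<1 , r<L-2-t) →
          case upper r<1 r<L-2-t (≤.total 1# (L - 2# - t)) of λ { (s , r<s , s≤1 , t+s≤L-2) →
          case neighbourIn v -1≤r r<s s≤1 of λ { (w , w—v , y , (r<y , y<s) , o′) →
          case h w w—v of λ { (x , (<x , x<) , o″) →
          let ρ = t ∷ y ∷ x ∷ r ∷ s ∷ []
              -- The closed walk from u by v and w back to u has length strictly between 0 and L,
              -- which is absurd.
              0≈t+y+x = offset-unique (offset-trans (offset-trans o o′) o″) (offset-zero (proj₁ u))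
                (arith ρ (:x₁ :< :x₄ ∷ :x₀ :+ :x₄ :≤ :L :- (:1 :+ :1) ∷ :x₂ :< :1 :+ :1 ∷ [])
                  (:x₀ :+ :x₁ :+ :x₂ :< :0 :+ :L) y<s t+s≤L-2 x<)
                (arith ρ (:x₃ :< :x₁ ∷ :1 :+ :1 :≤ :x₀ :+ :x₃ ∷ :- (:1 :+ :1) :< :x₂ ∷ [])
                  (:0 :< :x₀ :+ :x₁ :+ :x₂ :+ :L) r<y 2≤t+r <x)
          in ⊥-elim (<.irrefl refl
               (arith ρ (:x₃ :< :x₁ ∷ :1 :+ :1 :≤ :x₀ :+ :x₃ ∷ :- (:1 :+ :1) :< :x₂ ∷
                         :x₀ :+ :x₁ :+ :x₂ :≈ :0 ∷ []) (:0 :< :0) r<y 2≤t+r <x 0≈t+y+x)) } } } }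
          where
          lower : - 1# ≤ 2# - t ⊎ 2# - t ≤ - 1# →
                  ∃[ r ] - 1# ≤ r × 2# ≤ t + r × r < 1# × r < L - 2# - t
          lower (inj₁ g) = 2# - t , g ,
            arith (t ∷ []) [] (:1 :+ :1 :≤ :x₀ :+ (:1 :+ :1 :- :x₀)) ,
            arith (t ∷ []) (:1 :< :x₀ ∷ []) (:1 :+ :1 :- :x₀ :< :1) 1<t ,
            arith (t ∷ []) [] (:1 :+ :1 :- :x₀ :< :L :- (:1 :+ :1) :- :x₀)
          lower (inj₂ g) = - 1# , ≤.refl ,
            arith (t ∷ []) (:1 :+ :1 :- :x₀ :≤ :- :1 ∷ []) (:1 :+ :1 :≤ :x₀ :+ :- :1) g ,
            arith [] [] (:- :1 :< :1) ,
            arith (t ∷ []) (:x₀ :< :L :- :1 ∷ []) (:- :1 :< :L :- (:1 :+ :1) :- :x₀) t<L-1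

          upper : ∀ {r} → r < 1# → r < L - 2# - t → 1# ≤ L - 2# - t ⊎ L - 2# - t ≤ 1# →
                  ∃[ s ] r < s × s ≤ 1# × t + s ≤ L - 2#
          upper r<1 _ (inj₁ g) = 1# , r<1 , ≤.refl ,
            arith (t ∷ []) (:1 :≤ :L :- (:1 :+ :1) :- :x₀ ∷ []) (:x₀ :+ :1 :≤ :L :- (:1 :+ :1)) g
          upper _ r< (inj₂ g) = L - 2# - t , r< , g ,
            arith (t ∷ []) [] (:x₀ :+ (:L :- (:1 :+ :1) :- :x₀) :≤ :L :- (:1 :+ :1))

        by-cases : ∃[ t ] Offset (proj₁ u) (proj₁ v) t × 0# ≤ t × t < 0# + L → Near u v
        by-cases (t , o , 0≤t , t<L) =
          [ (λ t≤1 → t , (arith (t ∷ []) (:0 :≤ :x₀ ∷ []) (:- :1 :≤ :x₀) 0≤t , t≤1) , o)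
          , (λ 1<t →
              [ far o 1<t
              , (λ L-1≤t → t - L ,
                  ( arith (t ∷ []) (:L :- :1 :≤ :x₀ ∷ []) (:- :1 :≤ :x₀ :- :L) L-1≤t
                  , arith (t ∷ []) (:x₀ :< :0 :+ :L ∷ []) (:x₀ :- :L :≤ :1) t<L ) ,
                  offset-trans o (offset-sym (offset-length (proj₁ v)))) ]′
              (<-≤-total t (L - 1#))) ]′
          (≤-<-total t 1#)

  -- a and b lie within distance 1 of o, on the same side of it.
  SameSide : Vertex → Vertex → Vertex → Set
  SameSide o a b = Near o a × Near o b × ∃[ x ] Near x a × Near x b × ¬ Near x o

  [_,_⟩ : Carrier → Carrier → Pred Carrier 0ℓ
  [ r , s ⟩ t = r ≤ t × t < s

  far⇒¬near : ∀ u v {t} → Offset (proj₁ u) (proj₁ v) t → 1# < t → t < L - 1# → ¬ Near u v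
  far⇒¬near u v {t} o 1<t t<L-1 (s , (-1≤s , s≤1) , o′) =
    <.irrefl refl (arith (t ∷ s ∷ []) (:x₀ :≈ :x₁ ∷ :1 :< :x₀ ∷ :x₁ :≤ :1 ∷ []) (:0 :< :0)
      (offset-unique o o′
        (arith (t ∷ s ∷ []) (:x₀ :< :L :- :1 ∷ :- :1 :≤ :x₁ ∷ []) (:x₀ :< :x₁ :+ :L) t<L-1 -1≤s)
        (arith (t ∷ s ∷ []) (:1 :< :x₀ ∷ :x₁ :≤ :1 ∷ []) (:x₁ :< :x₀ :+ :L) 1<t s≤1))
      1<t s≤1)

  abstract
    -- The witness is taken at an offset from o between 1 and 1 + min(s, t): too far from o, but
    -- still near a and b.
    sameSide-above : ∀ o a b → Within ⟨ 0# , 1# ] o a → Within ⟨ 0# , 1# ] o b → SameSide o a b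
    sameSide-above o a b (s , (0<s , s≤1) , oa) (t , (0<t , t≤1) , ob) =
      case vertexIn₂ (proj₁ o) {1#} {1#} {s + 1#} {t + 1#}
             (1<x+1 0<s) (1<x+1 0<t) (1<x+1 0<s) (1<x+1 0<t)
      of λ { (x , y , ((1<y , y<s+1) , (_ , y<t+1)) , ox) →
        near a 0<s s≤1 oa , near b 0<t t≤1 ob , x ,
        beyond x a 1<y s≤1 y<s+1 ox oa , beyond x b 1<y t≤1 y<t+1 ox ob ,
        -- Since 1 < y < 2, the way up from x round to o has length between 1 and L - 1.
        far⇒¬near x o (offset-trans (offset-sym ox) (offset-length (proj₁ o)))
          (arith (y ∷ s ∷ []) (:x₀ :< :x₁ :+ :1 ∷ :x₁ :≤ :1 ∷ []) (:1 :< :- :x₀ :+ :L) y<s+1 s≤1)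
          (arith (y ∷ []) (:1 :< :x₀ ∷ []) (:- :x₀ :+ :L :< :L :- :1) 1<y) }
      where
      1<x+1 : ∀ {x} → 0# < x → 1# < x + 1#
      1<x+1 {x} = arith (x ∷ []) (:0 :< :x₀ ∷ []) (:1 :< :x₀ :+ :1)

      near : ∀ c {r} → 0# < r → r ≤ 1# → Offset (proj₁ o) (proj₁ c) r → Near o c
      near c {r} 0<r r≤1 oc =
        r , (arith (r ∷ []) (:0 :< :x₀ ∷ []) (:- :1 :≤ :x₀) 0<r , r≤1) , oc

      beyond : ∀ x c {y r} → 1# < y → r ≤ 1# → y < r + 1# →
               Offset (proj₁ o) (proj₁ x) y → Offset (proj₁ o) (proj₁ c) r → Near x c
      beyond x c {y} {r} 1<y r≤1 y<r+1 ox oc = - y + r ,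
        ( arith (y ∷ r ∷ []) (:x₀ :< :x₁ :+ :1 ∷ []) (:- :1 :≤ :- :x₀ :+ :x₁) y<r+1
        , arith (y ∷ r ∷ []) (:1 :< :x₀ ∷ :x₁ :≤ :1 ∷ []) (:- :x₀ :+ :x₁ :≤ :1) 1<y r≤1 ) ,
        offset-trans (offset-sym ox) oc

    sameSide-below : ∀ o a b → Within [ - 1# , 0# ⟩ o a → Within [ - 1# , 0# ⟩ o b →
                     SameSide o a b
    sameSide-below o a b (s , (-1≤s , s<0) , oa) (t , (-1≤t , t<0) , ob) =
      case vertexIn₂ (proj₁ o) {s - 1#} {t - 1#} { - 1# } { - 1# }
             (x-1<-1 s<0) (x-1<-1 s<0) (x-1<-1 t<0) (x-1<-1 t<0)
      of λ { (x , y , ((s-1<y , y<-1) , (t-1<y , _)) , ox) →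
        near a -1≤s s<0 oa , near b -1≤t t<0 ob , x ,
        beyond x a y<-1 -1≤s s-1<y ox oa , beyond x b y<-1 -1≤t t-1<y ox ob ,
        far⇒¬near x o (offset-sym ox)
          (arith (y ∷ []) (:x₀ :< :- :1 ∷ []) (:1 :< :- :x₀) y<-1)
          (arith (y ∷ s ∷ []) (:x₁ :- :1 :< :x₀ ∷ :- :1 :≤ :x₁ ∷ []) (:- :x₀ :< :L :- :1)
            s-1<y -1≤s) }
      where
      x-1<-1 : ∀ {x} → x < 0# → x - 1# < - 1#
      x-1<-1 {x} = arith (x ∷ []) (:x₀ :< :0 ∷ []) (:x₀ :- :1 :< :- :1)

      near : ∀ c {r} → - 1# ≤ r → r < 0# → Offset (proj₁ o) (proj₁ c) r → Near o c
      near c {r} -1≤r r<0 oc =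
        r , (-1≤r , arith (r ∷ []) (:x₀ :< :0 ∷ []) (:x₀ :≤ :1) r<0) , oc

      beyond : ∀ x c {y r} → y < - 1# → - 1# ≤ r → r - 1# < y →
               Offset (proj₁ o) (proj₁ x) y → Offset (proj₁ o) (proj₁ c) r → Near x c
      beyond x c {y} {r} y<-1 -1≤r r-1<y ox oc = - y + r ,
        ( arith (y ∷ r ∷ []) (:x₀ :< :- :1 ∷ :- :1 :≤ :x₁ ∷ []) (:- :1 :≤ :- :x₀ :+ :x₁) y<-1 -1≤r
        , arith (y ∷ r ∷ []) (:x₁ :- :1 :< :x₀ ∷ []) (:- :x₀ :+ :x₁ :≤ :1) r-1<y ) ,
        offset-trans (offset-sym ox) oc

  -- If a and b lie on different sides of o, a point near both of them is near o; it cannot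
  -- reach them the other way round the circle because L > 4.
  abstract
    straddle : ∀ o a b {s t} → Offset (proj₁ o) (proj₁ a) s → Offset (proj₁ o) (proj₁ b) t →
               0# ≤ s → s ≤ 1# → - 1# ≤ t → t ≤ 0# →
               ∀ x → Near x a → Near x b → Near x o
    straddle o a b {s} {t} oa ob 0≤s s≤1 -1≤t t≤0 x
             (y , (-1≤y , y≤1) , xa) (z , (-1≤z , z≤1) , xb) =
      let ρ = s ∷ t ∷ y ∷ z ∷ []
          y-s≈z-t = offset-unique (offset-trans xa (offset-sym oa)) (offset-trans xb (offset-sym ob))
            (arith ρ (:x₂ :≤ :1 ∷ :0 :≤ :x₀ ∷ :- :1 :≤ :x₃ ∷ :x₁ :≤ :0 ∷ [])
              (:x₂ :+ :- :x₀ :< :x₃ :+ :- :x₁ :+ :L) y≤1 0≤s -1≤z t≤0)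
            (arith ρ (:x₃ :≤ :1 ∷ :- :1 :≤ :x₁ ∷ :- :1 :≤ :x₂ ∷ :x₀ :≤ :1 ∷ [])
              (:x₃ :+ :- :x₁ :< :x₂ :+ :- :x₀ :+ :L) z≤1 -1≤t -1≤y s≤1)
      in y - s ,
         ( arith ρ (:x₂ :- :x₀ :≈ :x₃ :- :x₁ ∷ :- :1 :≤ :x₃ ∷ :x₁ :≤ :0 ∷ []) (:- :1 :≤ :x₂ :- :x₀)
             y-s≈z-t -1≤z t≤0
         , arith ρ (:x₂ :≤ :1 ∷ :0 :≤ :x₀ ∷ []) (:x₂ :- :x₀ :≤ :1) y≤1 0≤s ) ,
         offset-trans xa (offset-sym oa)

  abstract
    -- If b were not above o, `straddle` would force the witness to be near o.
    sameSide-above⁻¹ : ∀ o a b → Within ⟨ 0# , 1# ] o a → SameSide o a b →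
                       Within ⟨ 0# , 1# ] o b
    sameSide-above⁻¹ o a b (s , (0<s , s≤1) , oa)
                     (_ , (t , (-1≤t , t≤1) , ob) , x , xa , xb , ¬xo) =
      [ (λ 0<t → t , (0<t , t≤1) , ob)
      , (λ t≤0 → contradiction
          (straddle o a b oa ob (inj₁ 0<s) s≤1 -1≤t t≤0 x xa xb) ¬xo) ]′
      (<-≤-total 0# t)

  abstract
    sameSide-below⁻¹ : ∀ o a b → Within [ - 1# , 0# ⟩ o a → SameSide o a b →
                       Within [ - 1# , 0# ⟩ o b
    sameSide-below⁻¹ o a b (s , (-1≤s , s<0) , oa)
                     (_ , (t , (-1≤t , t≤1) , ob) , x , xa , xb , ¬xo) =
      [ (λ t<0 → t , (-1≤t , t<0) , ob)
      , (λ 0≤t → contradiction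
          (straddle o b a ob oa 0≤t t≤1 -1≤s (inj₁ s<0) x xb xa) ¬xo) ]′
      (<-≤-total t 0#)

  Above Below : Rel Vertex 0ℓ
  Above = Within ⟨ 0# , 1# ]
  Below = Within [ - 1# , 0# ⟩

  above⇒below : ∀ u v → Above u v → Below v u
  above⇒below u v (t , (0<t , t≤1) , o) = - t ,
    ( arith (t ∷ []) (:x₀ :≤ :1 ∷ []) (:- :1 :≤ :- :x₀) t≤1
    , arith (t ∷ []) (:0 :< :x₀ ∷ []) (:- :x₀ :< :0) 0<t ) , offset-sym o

  below⇒above : ∀ u v → Below u v → Above v u
  below⇒above u v (t , (-1≤t , t<0) , o) = - t ,
    ( arith (t ∷ []) (:x₀ :< :0 ∷ []) (:0 :< :- :x₀) t<0
    , arith (t ∷ []) (:- :1 :≤ :x₀ ∷ []) (:- :x₀ :≤ :1) -1≤t ) , offset-sym o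

  -- Definability of the orientation from two parameters.

  module Formulas (p q : Vertex) (p<q : Within ⟨ 0# , 1# ⟩ p q) where
    open DefinabilityFrom G (p ∷ q ∷ [])

    within-2ᵈ : Def₂ (Within ⟨ - 2# , 2# ⟩)
    within-2ᵈ = map₂ common-neighbour⇔ λ i j →
      ∃ᵈ (adjacentᵈ (suc i) zero ∧ᵈ adjacentᵈ zero (suc j))

    nearᵈ : Def₂ Near
    nearᵈ = map₂ neighbours-within-2⇔near λ i j →
      ∀ᵈ (adjacentᵈ zero (suc j) ⇒ᵈ within-2ᵈ zero (suc i))

    sameSideᵈ : Def₃ SameSide
    sameSideᵈ i j k = nearᵈ i j ∧ᵈ nearᵈ i k ∧ᵈ
      ∃ᵈ (nearᵈ zero (suc j) ∧ᵈ nearᵈ zero (suc k) ∧ᵈ ¬ᵈ nearᵈ zero (suc i))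

    -- The orientation of the pair (p, q) is carried to (x, y) in n steps, first moving the
    -- first point of a pair and then the second one.
    Oriented : ℕ → Rel Vertex 0ℓ
    Oriented zero    x y = proj₁ x ≋ proj₁ p × proj₁ y ≋ proj₁ q
    Oriented (suc n) x y =
      ∃[ u ] ∃[ v ] Oriented n u v × SameSide v u x × SameSide x v y

    orientedᵈ : ∀ n → Def₂ (Oriented n)
    orientedᵈ zero    i j = parameterᵈ zero i ∧ᵈ parameterᵈ (suc zero) j
    orientedᵈ (suc n) i j = ∃ᵈ (∃ᵈ (orientedᵈ n (suc zero) zero ∧ᵈ
      sameSideᵈ zero (suc zero) (suc (suc i)) ∧ᵈ sameSideᵈ (suc (suc i)) zero (suc (suc j))))

    -- Each comparison replaces one point of the pair by another on the same side of the point that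
    -- stays, so the order is kept.
    oriented⇒above : ∀ n x y → Oriented n x y → Above x y
    oriented⇒above zero x y (x≋p , y≋q) =
      let t , (0<t , t<1) , o = p<q
      in t , (0<t , inj₁ t<1) , 𝕊.trans (+-cong-≋ t x≋p) (𝕊.trans o (𝕊.sym y≋q))
    oriented⇒above (suc n) x y (u , v , uv , vux , xvy) =
      sameSide-above⁻¹ x v y
        (below⇒above v x (sameSide-below⁻¹ v u x (above⇒below u v (oriented⇒above n u v uv)) vux))
        xvy

    -- One step from (u, v) by (x, v) to (x, y): u and x lie below v, then v and y lie above x. The
    -- offsets τ, σ, t of u, v, x are all measured from q.
    carry : ∀ n {u v x y τ σ t} → Oriented n u v →
            Offset (proj₁ q) (proj₁ u) τ → Offset (proj₁ q) (proj₁ v) σ →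
            Offset (proj₁ q) (proj₁ x) t → τ < σ → t < σ → σ ≤ τ + 1# → σ ≤ t + 1# →
            Above x y → Oriented (suc n) x y
    carry n {u} {v} {x} {y} {τ} {σ} {t} uv qu qv qx τ<σ t<σ σ≤τ+1 σ≤t+1 xy =
      u , v , uv , sameSide-below v u x (below u qu τ<σ σ≤τ+1) (below x qx t<σ σ≤t+1) ,
      sameSide-above x v y (below⇒above v x (below x qx t<σ σ≤t+1)) xy
      where
      below : ∀ w {r} → Offset (proj₁ q) (proj₁ w) r → r < σ → σ ≤ r + 1# → Below v w
      below w {r} qw r<σ σ≤r+1 = - σ + r ,
        ( arith (r ∷ σ ∷ []) (:x₁ :≤ :x₀ :+ :1 ∷ []) (:- :1 :≤ :- :x₁ :+ :x₀) σ≤r+1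
        , arith (r ∷ σ ∷ []) (:x₀ :< :x₁ ∷ []) (:- :x₁ :+ :x₀ :< :0) r<σ ) ,
        offset-trans (offset-sym qv) qw

    -- Induction along the way up from q: one step from (p, q) covers offsets in (-1, 0), and each
    -- further step raises the first point by less than 1.
    above⇒oriented : ∀ n x {t} → Offset (proj₁ q) (proj₁ x) t → - 1# < t → t < n ·ℕ 1# →
                     ∀ y → Above x y → Oriented (suc n) x y
    above⇒oriented zero x {t} qx -1<t t<0 y xy =
      let s , (0<s , s<1) , pq = p<q
      in carry zero {p} {q} {x} {y} (𝕊.refl , 𝕊.refl) (offset-sym pq) (offset-zero (proj₁ q)) qx
           (arith (s ∷ []) (:0 :< :x₀ ∷ []) (:- :x₀ :< :0) 0<s) t<0
           (arith (s ∷ []) (:x₀ :< :1 ∷ []) (:0 :≤ :- :x₀ :+ :1) s<1)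
           (arith (t ∷ []) (:- :1 :< :x₀ ∷ []) (:0 :≤ :x₀ :+ :1) -1<t) xy
    above⇒oriented (suc n) x {t} qx -1<t t<1+n y xy =
      -- The previous first point u stays in the range (-1, n) of the induction hypothesis and less
      -- than 1 below x; then v is chosen above x and less than 1 above u.
      case vertexIn₂ (proj₁ q) { - 1# } {t - 1#} {t} {n ·ℕ 1#} -1<t
             (arith (n ·ℕ 1# ∷ []) (:0 :≤ :x₀ ∷ []) (:- :1 :< :x₀) (0≤n·1 n))
             (arith (t ∷ []) [] (:x₀ :- :1 :< :x₀))
             (arith (t ∷ n ·ℕ 1# ∷ []) (:x₀ :< :1 :+ :x₁ ∷ []) (:x₀ :- :1 :< :x₁) t<1+n)
      of λ { (u , τ , ((-1<τ , τ<t) , (t-1<τ , τ<n)) , qu) →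
      case vertexIn (proj₁ q) (arith (t ∷ τ ∷ []) (:x₀ :- :1 :< :x₁ ∷ []) (:x₀ :< :x₁ :+ :1) t-1<τ)
      of λ { (v , σ , (t<σ , σ<τ+1) , qv) →
      let ρ = t ∷ τ ∷ σ ∷ []
          τ<σ = <.trans τ<t t<σ
      in carry (suc n) {u} {v} {x} {y}
           (above⇒oriented n u qu -1<τ τ<n v
             ( - τ + σ
             , ( arith ρ (:x₁ :< :x₂ ∷ []) (:0 :< :- :x₁ :+ :x₂) τ<σ
               , arith ρ (:x₂ :< :x₁ :+ :1 ∷ []) (:- :x₁ :+ :x₂ :≤ :1) σ<τ+1 )
             , offset-trans (offset-sym qu) qv ))
           qu qv qx τ<σ t<σ (inj₁ σ<τ+1)
           (arith ρ (:x₂ :< :x₁ :+ :1 ∷ :x₁ :< :x₀ ∷ []) (:x₂ :≤ :x₀ :+ :1) σ<τ+1 τ<t) xy } }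

    turns : ∃[ N ] L < N ·ℕ 1#
    turns = archimedean em 0<1 L

    N : ℕ
    N = proj₁ turns

    L<N : L < N ·ℕ 1#
    L<N = proj₂ turns

    -- Every x has an offset from q in [0, L), which N exceeds, so one number of steps serves all
    -- pairs.
    oriented⇔above : ∀ x y → Oriented (suc N) x y ⇔ Above x y
    oriented⇔above x y = mk⇔ (oriented⇒above (suc N) x y) λ xy →
      case offset-from (proj₁ q) (proj₁ x) 0# of λ { (t , qx , 0≤t , t<L) →
        above⇒oriented N x qx
          (arith (t ∷ []) (:0 :≤ :x₀ ∷ []) (:- :1 :< :x₀) 0≤t)
          (arith (t ∷ N ·ℕ 1# ∷ []) (:x₀ :< :0 :+ :L ∷ :L :< :x₁ ∷ []) (:x₀ :< :x₁) t<L L<N)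
          y xy }

    aboveᵈ : Def₂ Above
    aboveᵈ = map₂ oriented⇔above (orientedᵈ (suc N))

    -- A vertex w beyond v and still at most 1 above u excludes length exactly 1; density provides
    -- one when v is short of 1.
    above-strict⇔ : ∀ u v → (Above u v × ∃[ w ] Above u w × Above v w) ⇔ Within ⟨ 0# , 1# ⟩ u v
    above-strict⇔ u v = mk⇔
      (λ ((r , (0<r , r≤1) , uv) , w , (s , (0<s , s≤1) , uw) , (t , (0<t , t≤1) , vw)) →
        let ρ = r ∷ s ∷ t ∷ []
            r+t≈s = offset-unique (offset-trans uv vw) uw
              (arith ρ (:x₀ :≤ :1 ∷ :x₂ :≤ :1 ∷ :0 :< :x₁ ∷ []) (:x₀ :+ :x₂ :< :x₁ :+ :L) r≤1 t≤1 0<s)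
              (arith ρ (:x₁ :≤ :1 ∷ :0 :< :x₀ ∷ :0 :< :x₂ ∷ []) (:x₁ :< :x₀ :+ :x₂ :+ :L) s≤1 0<r 0<t)
        in r , (0<r , arith ρ (:x₀ :+ :x₂ :≈ :x₁ ∷ :x₁ :≤ :1 ∷ :0 :< :x₂ ∷ []) (:x₀ :< :1)
                        r+t≈s s≤1 0<t) , uv)
      (λ (r , (0<r , r<1) , uv) → (r , (0<r , inj₁ r<1) , uv) ,
        (case vertexIn (proj₁ u) r<1 of λ { (w , s , (r<s , s<1) , uw) →
          w , (s , (<.trans 0<r r<s , inj₁ s<1) , uw) ,
          (- r + s ,
            ( arith (r ∷ s ∷ []) (:x₀ :< :x₁ ∷ []) (:0 :< :- :x₀ :+ :x₁) r<s
            , arith (r ∷ s ∷ []) (:0 :< :x₀ ∷ :x₁ :< :1 ∷ []) (:- :x₀ :+ :x₁ :≤ :1) 0<r s<1 ) ,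
            offset-trans (offset-sym uv) uw) }))

    -- Arcs with integer ends.

    Arc : Carrier → Carrier → Rel Vertex 0ℓ
    Arc r s = Within ⟨ r , s ⟩

    arc-0-1ᵈ : Def₂ (Arc 0# 1#)
    arc-0-1ᵈ = map₂ above-strict⇔ λ i j →
      aboveᵈ i j ∧ᵈ ∃ᵈ (aboveᵈ (suc i) zero ∧ᵈ aboveᵈ (suc j) zero)

    arc-resp-≈ : ∀ {r r′ s s′} → r ≈ r′ → s ≈ s′ → ∀ u v → Arc r s u v → Arc r′ s′ u v
    arc-resp-≈ r≈ s≈ u v (t , (r<t , t<s) , o) =
      t , (<.<-respˡ-≈ r≈ r<t , <.<-respʳ-≈ s≈ t<s) , o

    arc-congᵈ : ∀ {r r′ s s′} → r ≈ r′ → s ≈ s′ → Def₂ (Arc r s) → Def₂ (Arc r′ s′)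
    arc-congᵈ r≈ s≈ = map₂ λ u v →
      mk⇔ (arc-resp-≈ r≈ s≈ u v) (arc-resp-≈ (sym r≈) (sym s≈) u v)

    reverseᵈ : ∀ {r s} → Def₂ (Arc r s) → Def₂ (Arc (- s) (- r))
    reverseᵈ {r} {s} def = map₂ iff (λ i j → def j i)
      where
      iff : ∀ u v → Arc r s v u ⇔ Arc (- s) (- r) u v
      iff u v = mk⇔
        (λ (t , (r<t , t<s) , o) → - t ,
          ( arith (t ∷ s ∷ []) (:x₀ :< :x₁ ∷ []) (:- :x₁ :< :- :x₀) t<s
          , arith (t ∷ r ∷ []) (:x₁ :< :x₀ ∷ []) (:- :x₀ :< :- :x₁) r<t ) , offset-sym o)
        (λ (t , (-s<t , t<-r) , o) → - t ,
          ( arith (t ∷ r ∷ []) (:x₀ :< :- :x₁ ∷ []) (:x₁ :< :- :x₀) t<-r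
          , arith (t ∷ s ∷ []) (:- :x₁ :< :x₀ ∷ []) (:- :x₀ :< :x₁) -s<t ) , offset-sym o)

    -- Open intervals add end by end: w must have its offset from u in (r, s) and in (t - s′, t -
    -- r′), which overlap when t lies in (r + r′, s + s′).
    compose⇔ : ∀ {r s r′ s′} → r < s → r′ < s′ → ∀ u v →
               (∃[ w ] Arc r s u w × Arc r′ s′ w v) ⇔ Arc (r + r′) (s + s′) u v
    compose⇔ {r} {s} {r′} {s′} r<s r′<s′ u v = mk⇔
      (λ (w , (t , (r<t , t<s) , o) , (t′ , (r′<t′ , t′<s′) , o′)) → t + t′ ,
        ( arith (t ∷ t′ ∷ r ∷ r′ ∷ []) (:x₂ :< :x₀ ∷ :x₃ :< :x₁ ∷ []) (:x₂ :+ :x₃ :< :x₀ :+ :x₁)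
            r<t r′<t′
        , arith (t ∷ t′ ∷ s ∷ s′ ∷ []) (:x₀ :< :x₂ ∷ :x₁ :< :x₃ ∷ []) (:x₀ :+ :x₁ :< :x₂ :+ :x₃)
            t<s t′<s′ ) , offset-trans o o′)
      (λ (t , (<t , t<) , o) →
        case vertexIn₂ (proj₁ u) {r} {t - s′} {s} {t - r′} r<s
               (arith (t ∷ r ∷ r′ ∷ []) (:x₁ :+ :x₂ :< :x₀ ∷ []) (:x₁ :< :x₀ :- :x₂) <t)
               (arith (t ∷ s ∷ s′ ∷ []) (:x₀ :< :x₁ :+ :x₂ ∷ []) (:x₀ :- :x₂ :< :x₁) t<)
               (arith (t ∷ r′ ∷ s′ ∷ []) (:x₁ :< :x₂ ∷ []) (:x₀ :- :x₂ :< :x₀ :- :x₁) r′<s′)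
        of λ { (w , y , ((r<y , y<s) , (<y , y<)) , o′) →
          w , (y , (r<y , y<s) , o′) , (- y + t ,
            ( arith (t ∷ y ∷ r′ ∷ []) (:x₁ :< :x₀ :- :x₂ ∷ []) (:x₂ :< :- :x₁ :+ :x₀) y<
            , arith (t ∷ y ∷ s′ ∷ []) (:x₀ :- :x₂ :< :x₁ ∷ []) (:- :x₁ :+ :x₀ :< :x₂) <y ) ,
            offset-trans (offset-sym o′) o) })

    composeᵈ : ∀ {r s r′ s′} → r < s → r′ < s′ → Def₂ (Arc r s) → Def₂ (Arc r′ s′) →
               Def₂ (Arc (r + r′) (s + s′))
    composeᵈ r<s r′<s′ def def′ = map₂ (compose⇔ r<s r′<s′) λ i j →
      ∃ᵈ (def (suc i) zero ∧ᵈ def′ zero (suc j))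

    -- The points w of the condition are those of [r + 1, r + 2⟩.
    shift⇔ : ∀ {r} u v →
      (Arc r (r + 2#) u v × ∃[ w ] Arc r (r + 2#) u w × ¬ Arc r (r + 1#) u w × Arc 0# 1# w v) ⇔
      Arc (r + 1#) (r + 2#) u v
    shift⇔ {r} u v = mk⇔
      (λ ((t , (r<t , t<r+2) , uv) , w , (s , (r<s , s<r+2) , uw) , ¬uw , (y , (0<y , y<1) , wv)) →
        [ (λ s<r+1 → contradiction (s , (r<s , s<r+1) , uw) ¬uw)
        , (λ r+1≤s →
            let ρ = r ∷ s ∷ t ∷ y ∷ []
                t≈s+y = offset-unique uv (offset-trans uw wv)
                  (arith ρ (:x₂ :< :x₀ :+ (:1 :+ :1) ∷ :x₀ :< :x₁ ∷ :0 :< :x₃ ∷ [])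
                    (:x₂ :< :x₁ :+ :x₃ :+ :L) t<r+2 r<s 0<y)
                  (arith ρ (:x₁ :< :x₀ :+ (:1 :+ :1) ∷ :x₃ :< :1 ∷ :x₀ :< :x₂ ∷ [])
                    (:x₁ :+ :x₃ :< :x₂ :+ :L) s<r+2 y<1 r<t)
            in t , (arith ρ (:x₂ :≈ :x₁ :+ :x₃ ∷ :x₀ :+ :1 :≤ :x₁ ∷ :0 :< :x₃ ∷ [])
                      (:x₀ :+ :1 :< :x₂) t≈s+y r+1≤s 0<y , t<r+2) , uv) ]′
        (<-≤-total s (r + 1#)))
      (λ (t , (r+1<t , t<r+2) , uv) →
        (t , (arith (r ∷ t ∷ []) (:x₀ :+ :1 :< :x₁ ∷ []) (:x₀ :< :x₁) r+1<t , t<r+2) , uv) ,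
        (case vertexIn (proj₁ u) r+1<t of λ { (w , s , (r+1<s , s<t) , uw) →
          let ρ = r ∷ s ∷ t ∷ [] in w ,
          (s , (arith ρ (:x₀ :+ :1 :< :x₁ ∷ []) (:x₀ :< :x₁) r+1<s , <.trans s<t t<r+2) , uw) ,
          (λ (y , (r<y , y<r+1) , uw′) →
            let ρ′ = r ∷ s ∷ t ∷ y ∷ []
                s≈y = offset-unique uw uw′
                  (arith ρ′ (:x₁ :< :x₂ ∷ :x₂ :< :x₀ :+ (:1 :+ :1) ∷ :x₀ :< :x₃ ∷ [])
                    (:x₁ :< :x₃ :+ :L) s<t t<r+2 r<y)
                  (arith ρ′ (:x₃ :< :x₀ :+ :1 ∷ :x₀ :+ :1 :< :x₁ ∷ []) (:x₃ :< :x₁ :+ :L)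
                    y<r+1 r+1<s)
            in <.irrefl refl (arith ρ′ (:x₁ :≈ :x₃ ∷ :x₃ :< :x₀ :+ :1 ∷ :x₀ :+ :1 :< :x₁ ∷ [])
                 (:0 :< :0) s≈y y<r+1 r+1<s)) ,
          (- s + t ,
            ( arith ρ (:x₁ :< :x₂ ∷ []) (:0 :< :- :x₁ :+ :x₂) s<t
            , arith ρ (:x₀ :+ :1 :< :x₁ ∷ :x₂ :< :x₀ :+ (:1 :+ :1) ∷ []) (:- :x₁ :+ :x₂ :< :1)
                r+1<s t<r+2 ) ,
            offset-trans (offset-sym uw) uv) }))

    -- Composition adds lengths, so it cannot by itself move a unit arc; `shift⇔` cuts the first
    -- half off (r, r + 2).
    shiftᵈ : ∀ {r} → Def₂ (Arc r (r + 1#)) → Def₂ (Arc (r + 1#) (r + 2#))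
    shiftᵈ {r} def = map₂ shift⇔ λ i j →
      def₂ i j ∧ᵈ ∃ᵈ (def₂ (suc i) zero ∧ᵈ (¬ᵈ def (suc i) zero) ∧ᵈ arc-0-1ᵈ zero (suc j))
      where
      def₂ : Def₂ (Arc r (r + 2#))
      def₂ = arc-congᵈ (+-identityʳ r) (+-assoc r 1# 1#)
        (composeᵈ (arith (r ∷ []) [] (:x₀ :< :x₀ :+ :1)) 0<1 def arc-0-1ᵈ)

    unitArcᵈℕ : ∀ n → Def₂ (Arc (n ·ℕ 1#) (n ·ℕ 1# + 1#))
    unitArcᵈℕ zero    = arc-congᵈ refl (sym (+-identityˡ 1#)) arc-0-1ᵈ
    unitArcᵈℕ (suc n) = arc-congᵈ (+-comm (n ·ℕ 1#) 1#)
      (arith (n ·ℕ 1# ∷ []) [] (:x₀ :+ (:1 :+ :1) :≈ :1 :+ :x₀ :+ :1))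
      (shiftᵈ (unitArcᵈℕ n))

    unitArcᵈ : ∀ z → Def₂ (Arc (fromℤ z) (fromℤ z + 1#))
    unitArcᵈ (+ n)    = unitArcᵈℕ n
    -- This is the reverse of the arc (n, n + 1).
    unitArcᵈ -[1+ n ] = arc-congᵈ (-‿cong (+-comm (n ·ℕ 1#) 1#))
      (arith (n ·ℕ 1# ∷ []) [] (:- :x₀ :≈ :- (:1 :+ :x₀) :+ :1))
      (reverseᵈ (unitArcᵈℕ n))

    arcᵈ : ∀ z n → Def₂ (Arc (fromℤ z) (fromℤ z + suc n ·ℕ 1#))
    arcᵈ z zero    = arc-congᵈ refl (+-congˡ (sym (+-identityʳ 1#))) (unitArcᵈ z)
    arcᵈ z (suc n) = arc-congᵈ (+-identityʳ (fromℤ z))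
      (arith (fromℤ z ∷ n ·ℕ 1# ∷ []) [] (:x₀ :+ (:1 :+ :x₁) :+ :1 :≈ :x₀ :+ (:1 :+ (:1 :+ :x₁))))
      (composeᵈ
        (arith (fromℤ z ∷ n ·ℕ 1# ∷ []) (:0 :≤ :x₁ ∷ []) (:x₀ :< :x₀ :+ (:1 :+ :x₁)) (0≤n·1 n))
        0<1 (arcᵈ z n) arc-0-1ᵈ)

    -- Translations and the circular order.

    translation⇔ : ∀ r u v →
      (Arc (r - 1#) (r + 1#) u v × ¬ Arc (r - 1#) r u v × ¬ Arc r (r + 1#) u v) ⇔
      Offset (proj₁ u) (proj₁ v) r
    translation⇔ r u v = mk⇔
      (λ ((t , (r-1<t , t<r+1) , uv) , ¬l , ¬u) → offset-resp-≈
        (≤.antisym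
          (≮⇒≥ λ r<t → ¬u (t , (r<t , t<r+1) , uv))
          (≮⇒≥ λ t<r → ¬l (t , (r-1<t , t<r) , uv))) uv)
      (λ uv →
        (r , ( arith (r ∷ []) [] (:x₀ :- :1 :< :x₀) , arith (r ∷ []) [] (:x₀ :< :x₀ :+ :1)) , uv) ,
        (λ (t , (r-1<t , t<r) , uv′) → <.irrefl
          (offset-unique uv′ uv
            (arith (r ∷ t ∷ []) (:x₁ :< :x₀ ∷ []) (:x₁ :< :x₀ :+ :L) t<r)
            (arith (r ∷ t ∷ []) (:x₀ :- :1 :< :x₁ ∷ []) (:x₀ :< :x₁ :+ :L) r-1<t)) t<r) ,
        (λ (t , (r<t , t<r+1) , uv′) → <.irrefl
          (offset-unique uv uv′
            (arith (r ∷ t ∷ []) (:x₀ :< :x₁ ∷ []) (:x₀ :< :x₁ :+ :L) r<t)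
            (arith (r ∷ t ∷ []) (:x₁ :< :x₀ :+ :1 ∷ []) (:x₁ :< :x₀ :+ :L) t<r+1)) r<t))

    translationᵈ : ∀ z → Def₂ (λ u v → Offset (proj₁ u) (proj₁ v) (fromℤ z))
    translationᵈ z = map₂ (translation⇔ (fromℤ z)) λ i j →
      both i j ∧ᵈ (¬ᵈ lower i j) ∧ᵈ (¬ᵈ unitArcᵈ z i j)
      where
      r = fromℤ z

      lower : Def₂ (Arc (r - 1#) r)
      lower = arc-congᵈ pred≈ (trans (+-congʳ pred≈) (x-y+y≈x r 1#)) (unitArcᵈ (z ℤ.- + 1))
        where
        pred≈ : fromℤ (z ℤ.- + 1) ≈ r - 1#
        pred≈ = trans (fromℤ-minus z (+ 1)) (+-congˡ (-‿cong (+-identityʳ 1#)))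

      both : Def₂ (Arc (r - 1#) (r + 1#))
      both = arc-congᵈ (+-identityʳ (r - 1#)) refl
        (composeᵈ (arith (r ∷ []) [] (:x₀ :- :1 :< :x₀)) 0<1 lower arc-0-1ᵈ)

    translatedArcᵈ : ∀ z t n →
      Def₂ (λ u v → OffsetIn ⟨ 0# , suc n ·ℕ 1# ⟩ (proj₁ u ⊕ z) (proj₁ v ⊕ t))
    translatedArcᵈ z t n = map₂
      (λ u v → offsetIn-translate (proj₁ u) (proj₁ v) z t (suc n ·ℕ 1#)) (arcᵈ (z ℤ.- t) n)

    cyclicᵈ : ∀ z t k →
      Def₃ (λ u v w → C (proj₁ u ⊕ z) (proj₁ v ⊕ t) (proj₁ w ⊕ k))
    cyclicᵈ z t k h i j = mapᵈ
      (λ vs →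
        let a = proj₁ (lookup vs h) ⊕ z
            b = proj₁ (lookup vs i) ⊕ t
            c = proj₁ (lookup vs j) ⊕ k
        in ⇔-sym (turn⇔arcsAround L<N {a} {b} {c} ⇔-∘ C⇔turn {a} {b} {c}))
      (∃<ᵈ N λ l → ∃<ᵈ N λ m → ∃<ᵈ N λ n →
        constantᵈ (suc l ·ℕ 1# + suc m ·ℕ 1# + suc n ·ℕ 1# <.<? L + L) ∧ᵈ
        translatedArcᵈ z t l h i ∧ᵈ translatedArcᵈ t k m i j ∧ᵈ translatedArcᵈ k z n j h)

corollary2p14 : (em : ExcludedMiddle 0ℓ) (ℝ : CompleteOrderedField) →
    let open CompleteOrderedField ℝ in
    (L : Carrier) (4<L : fromℤ (+ 4) < L) →
    let open Circle em ℝ L (RealLemmas.4<x⇒2≤x ℝ 4<L) in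
    (S : Pred Carrier 0ℓ) → S Respects _≋_ → Dense S →
    (G : SimpleGraph (Subspace S)) → GeometricallyExistentiallyClosed S G →
    let open Definability G in
    ((z t k : ℤ) → Definable (C[_,_,_] S z t k)) ×
    ((z : ℤ) → DefinablePartialFunction (dom-f S z) (f S z))
corollary2p14 em ℝ L 4<L S S-resp S-dense G gec =
  (λ z t k → definable (mapᵈ (λ { (a ∷ b ∷ c ∷ []) → mk⇔ id id })
    (cyclicᵈ z t k {3} zero (suc zero) (suc (suc zero))))) ,
  (λ z → definable (mapᵈ
    -- The translate of u is congruent to the vertex v, so it belongs to S, as the domain of the
    -- partial function demands.
    (λ { (u ∷ v ∷ []) → mk⇔ (λ o → S-resp (𝕊.sym o) (proj₂ v) , o) proj₂ })
    (translationᵈ z {2} zero (suc zero))))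
  where
  open CompleteOrderedField ℝ using (0#; 1#; 0<1)
  open Circle em ℝ L (RealLemmas.4<x⇒2≤x ℝ 4<L) using () renaming (𝕊 to circle)
  module 𝕊 = Setoid circle
  open CircleOffsets em ℝ L 4<L
  open GECGraph em ℝ L 4<L S S-dense G gec

  -- Some vertex p and a vertex q less than 1 above it fix an orientation of the circle.
  p = proj₁ (vertexIn 0# 0<1)
  q = proj₁ (vertexIn (proj₁ p) 0<1)

  open DefinabilityFrom G (p ∷ q ∷ [])
  open Formulas p q (proj₂ (vertexIn (proj₁ p) 0<1))
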